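{- Let $k$ be a constant and let $G=(V,E)$ be a graph with $n$ vertices and treewidth at most $k$. Then the number of isomorphism classes of good pairs of $G$ is $2^{O(n/\log n)}$.
   Context: All graphs are finite, simple and undirected; $N(v)$ denotes the set of neighbours of $v$. The treewidth of $G$ is the minimum width of a tree decomposition of $G$ (a tree decomposition is a tree $T$ with bags $X_i\subseteq V$ covering $V$ and every edge, such that for each vertex the bags containing it induce a connected subtree; its width is the maximum bag size minus one). A good pair of $G$ is a pair $(X,W)$ of subsets of $V$ such that $|X|\leq k+1$, $X\cap W=\emptyset$, and $N(v)\subseteq W\cup X$ for all $v\in W$ (equivalently, $W$ is a union of zero or more connected components of $G[V\setminus X]$). Two good pairs $(X,W)$ and $(X',Z)$ are isomorphic if $X=X'$ and there is a bijection $f: X\cup W\to X\cup Z$ with $f(v)=v$ for all $v\in X$ and, for all $v,w\in X\cup W$, $\{v,w\}\in E \Leftrightarrow \{f(v),f(w)\}\in E$. -}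

module Defs where

open import Data.Nat using (ℕ; suc; _≤_; _+_)
open import Data.Bool using (Bool; true; false)
open import Data.Fin using (Fin)
open import Data.Fin.Subset using (Subset; _∈_; _∪_; ∣_∣)
open import Data.List using (List; []; _∷_; _++_; length)
open import Data.List.Relation.Unary.Linked using (Linked)
open import Data.List.Relation.Unary.Unique.Propositional using (Unique)
open import Data.Product using (Σ; ∃; _×_; _,_; proj₁)
open import Data.Sum using (_⊎_)
open import Data.Empty using (⊥)
open import Data.Unit using (⊤)
open import Relation.Nullary using (¬_)
open import Relation.Binary.PropositionalEquality using (_≡_)
open import Function.Bundles using (_⤖_; Bijection)

record Graph (n : ℕ) : Set where
  field
    adj    : Fin n → Fin n → Bool
    sym    : ∀ u v → adj u v ≡ adj v u
    irrefl : ∀ v → adj v v ≡ false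
open Graph public

Edge : ∀ {n} → Graph n → Fin n → Fin n → Set
Edge G u v = adj G u v ≡ true

data WalkIn {n} (G : Graph n) (P : Fin n → Set) : Fin n → Fin n → Set where
  here : ∀ {u} → P u → WalkIn G P u u
  step : ∀ {u w v} → P u → Edge G u w → WalkIn G P w v → WalkIn G P u v

ConnectedOn : ∀ {n} → Graph n → (Fin n → Set) → Set
ConnectedOn G P = ∀ u v → P u → P v → WalkIn G P u v

Connected : ∀ {n} → Graph n → Set
Connected G = ∀ u v → WalkIn G (λ _ → ⊤) u v

HasCycle : ∀ {n} → Graph n → Set
HasCycle {n} G = Σ (Fin n) λ u → Σ (List (Fin n)) λ ws →
  (2 ≤ length ws) × Unique (u ∷ ws) × Linked (Edge G) (u ∷ ws ++ u ∷ [])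

IsTree : ∀ {n} → Graph n → Set
IsTree G = Connected G × ¬ HasCycle G

record TreeDecompositionOfWidth≤ {n} (G : Graph n) (k : ℕ) : Set where
  field
    m        : ℕ
    T        : Graph (suc m)
    isTree   : IsTree T
    bag      : Fin (suc m) → Subset n
    bagSize  : ∀ i → ∣ bag i ∣ ≤ suc k
    covers   : ∀ v → ∃ λ i → v ∈ bag i
    edges    : ∀ u v → Edge G u v → ∃ λ i → (u ∈ bag i) × (v ∈ bag i)
    subtree  : ∀ v → ConnectedOn T (λ i → v ∈ bag i)

TreewidthAtMost : ∀ {n} → Graph n → ℕ → Set
TreewidthAtMost G k = TreeDecompositionOfWidth≤ G k

GoodPair : ∀ {n} → Graph n → ℕ → Subset n × Subset n → Set
GoodPair G k (X , W) =
  (∣ X ∣ ≤ k + 1) ×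
  (∀ v → v ∈ X → v ∈ W → ⊥) ×
  (∀ v → v ∈ W → ∀ u → Edge G v u → (u ∈ W ⊎ u ∈ X))

Dom : ∀ {n} → Subset n → Subset n → Set
Dom {n} X W = Σ (Fin n) λ v → v ∈ (X ∪ W)

Iso : ∀ {n} → Graph n → Subset n × Subset n → Subset n × Subset n → Set
Iso G (X , W) (X' , Z) =
  (X ≡ X') × Σ (Dom X W ⤖ Dom X' Z) λ f →
    (∀ v (p : v ∈ (X ∪ W)) → v ∈ X → proj₁ (Bijection.to f (v , p)) ≡ v) ×
    (∀ a b → adj G (proj₁ a) (proj₁ b)
             ≡ adj G (proj₁ (Bijection.to f a)) (proj₁ (Bijection.to f b)))

{-# OPTIONS --safe #-}

-- Every W in a good pair (X , W) is a union of components of G − X. At most O(n / log n)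
-- components are large (more than c log n vertices), so choosing among them gives
-- 2 ^ O(n / log n) possibilities. The small ones fall into O(√n) isomorphism types over X,
-- and it suffices to know how many of each type are chosen: (n + 1) ^ O(√n) possibilities. There
-- are at most (n + 1) ^ (k + 1) sets X.
--
-- That s-vertex graphs of treewidth ≤ k have only 2 ^ O(s) types is seen by eliminating vertices
-- along the tree decomposition: this gives a rooted forest on V and a colouring with k + 1
-- colours such that each neighbour of v above v is the nearest ancestor of v of its colour. So
-- the forest, with each vertex labelled by its colour and the set of colours of its neighbours
-- above it, determines the graph; and this structure is inherited by every set of vertices.
module Submission where

-- What has to be bounded is the length of a description of a component that forgets the names of
-- its vertices. The tree decomposition itself is unsuitable: cut down to s vertices, it may still
-- have far more than s nodes. A forest on the vertices has one node per vertex, and deleting a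
-- vertex only moves its children up. The condition on nearest ancestors survives deletion because
-- it is a prohibition: no vertex of the colour of `v` lies strictly between `v` and a neighbour of
-- `v` below it.
--
-- Descriptions need only be sound. Equal descriptions give components that are isomorphic over `X`;
-- isomorphic components may well receive different ones, since they sit differently in the one
-- fixed forest. This only lengthens the list of representatives.

open import Defs renaming (sym to adj-sym; irrefl to adj-irrefl)
open import Data.Bool using (Bool; true; false)
import Data.Bool.Properties as Bool
open import Data.Empty using (⊥)
open import Data.Fin using (Fin; zero; suc)
import Data.Fin.Properties as Fin
open import Data.Fin.Subset using (Subset; ∣_∣; inside; outside; _∪_) renaming (_∈_ to _∈ₛ_; _∉_ to _∉ₛ_)
open import Data.Fin.Subset.Properties using (_∈?_; ∣p∣≤n; x∈p∪q⁺; x∈p∪q⁻)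
open import Data.List
  using (List; []; _∷_; _++_; length; map; concatMap; filter; cartesianProductWith;
         cartesianProduct; upTo; allFin; lookup; take)
open import Data.List.Properties
  using (length-map; length-++; length-upTo; length-tabulate; length-take; map-cong-local;
         filter-accept; filter-reject; filter-none; length-filter; ≡-dec; ∷-injective; map-++;
         filter-++; ++-assoc; ++-identityʳ)
open import Data.List.Membership.Propositional using (_∈_; _∉_; find; lose)
open import Data.List.Membership.Propositional.Properties
  using (∈-map⁺; ∈-map⁻; ∈-++⁺ˡ; ∈-++⁺ʳ; ∈-++⁻; ∈-cartesianProductWith⁺; ∈-upTo⁺; ∈-allFin;
         ∈-filter⁺; ∈-filter⁻; ∈-∃++; ∈-lookup; ∈-concatMap⁺; ∈-concatMap⁻; ∈-cartesianProduct⁺)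
open import Data.List.Relation.Binary.Permutation.Propositional
  using (_↭_; ↭-refl; ↭-sym; ↭-trans; ↭-reflexive; ↭⇒↭ₛ; prep)
open import Data.List.Relation.Binary.Permutation.Propositional.Properties
  using (shift; filter-↭; ↭-length; ∈-resp-↭)
import Data.List.Relation.Binary.Permutation.Setoid.Properties as Permutation
open import Data.List.Relation.Unary.All as All using (All; []; _∷_)
import Data.List.Relation.Unary.All.Properties as All
open import Data.List.Relation.Unary.AllPairs as AllPairs using (AllPairs; []; _∷_)
import Data.List.Relation.Unary.AllPairs.Properties as AllPairs
open import Data.List.Relation.Unary.Linked using (Linked; []; [-]; _∷_)
open import Data.List.Relation.Unary.Any as Any using (Any; here; there)
import Data.List.Relation.Unary.Any.Properties as Any
open import Data.Maybe using (Maybe; just; nothing)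
import Data.Maybe.Properties as Maybe
open import Data.Nat
  using (ℕ; zero; suc; _+_; _*_; _^_; _/_; _%_; _∸_; ⌊_/2⌋; ⌈_/2⌉; _≤_; _<_; z≤n; s≤s; _≤?_;
         NonZero; >-nonZero)
open import Data.Nat.DivMod using (m*n/n≡m; /-monoˡ-≤; m≡m%n+[m/n]*n; m%n<n; m/n*n≤m)
open import Data.Nat.Induction using (<-rec)
open import Data.Nat.Logarithm using (⌊log₂_⌋; ⌊log₂⌋-mono-≤; ⌊log₂[2^n]⌋≡n; ⌊log₂⌊n/2⌋⌋≡⌊log₂n⌋∸1)
open import Data.Nat.ListAction using (product)
open import Data.Nat.Properties
open import Data.Nat.Solver using (module +-*-Solver)
open import Data.Product using (∃; _×_; _,_; proj₁; proj₂)
import Data.Product.Properties as Product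
open import Data.Sum using (_⊎_; inj₁; inj₂; [_,_]′)
import Data.Sum.Properties as Sum
open import Data.Vec as Vec using (_∷_; []; here; there)
open import Data.Vec.Properties using ([]=⇒lookup; lookup⇒[]=)
open import Data.Vec.Properties.WithK using ([]=-irrelevant)
open import Data.Vec.Functional using () renaming (_∷_ to _◂_)
open import Function using (_∘_; id)
open import Function.Bundles using (mk⤖)
open import Relation.Binary.Definitions using (DecidableEquality; Symmetric)
open import Relation.Binary.PropositionalEquality
  using (_≡_; _≢_; refl; sym; trans; cong; cong₂; subst; setoid; module ≡-Reasoning)
open import Relation.Nullary using (¬_; yes; no; contradiction; ¬?; _×-dec_; _⊎-dec_; _→-dec_)
open import Relation.Unary using (Decidable)

-- Enumerations

length-cartesianProductWith : ∀ {A B C : Set} (f : A → B → C) xs ys →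
  length (cartesianProductWith f xs ys) ≡ length xs * length ys
length-cartesianProductWith f []       ys = refl
length-cartesianProductWith f (x ∷ xs) ys =
  trans (length-++ (map (f x) ys))
    (cong₂ _+_ (length-map (f x) ys) (length-cartesianProductWith f xs ys))

words : {A : Set} → List A → ℕ → List (List A)
words as zero    = [] ∷ []
words as (suc s) = [] ∷ cartesianProductWith _∷_ as (words as s)

∈-words : {A : Set} {as : List A} → ∀ {w s} → All (_∈ as) w → length w ≤ s → w ∈ words as s
∈-words {s = zero}  []        _       = here refl
∈-words {s = suc s} []        _       = here refl
∈-words {s = suc s} (a∈ ∷ w∈) (s≤s p) =
  there (∈-cartesianProductWith⁺ _∷_ a∈ (∈-words w∈ p))

-- Padding with an end mark turns a word of length at most `s` into one of length exactly `s`; the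
-- mark accounts for the extra 1 in the base.
length-words : {A : Set} (as : List A) → ∀ s → length (words as s) ≤ suc (length as) ^ s
length-words as zero    = ≤-refl
length-words as (suc s) = begin
  suc (length (cartesianProductWith _∷_ as (words as s)))
    ≡⟨ cong suc (length-cartesianProductWith _∷_ as (words as s)) ⟩
  suc (length as * length (words as s))
    ≤⟨ s≤s (*-monoʳ-≤ (length as) (length-words as s)) ⟩
  suc (length as * suc (length as) ^ s)
    ≤⟨ +-monoˡ-≤ _ (m^n>0 (suc (length as)) s) ⟩
  suc (length as) ^ suc s ∎
  where open ≤-Reasoning

boxes : List ℕ → List (List ℕ)
boxes []       = [] ∷ []
boxes (b ∷ bs) = cartesianProductWith _∷_ (upTo (suc b)) (boxes bs)

∈-boxes : {A : Set} {f g : A → ℕ} → (∀ a → f a ≤ g a) → ∀ as → map f as ∈ boxes (map g as)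
∈-boxes f≤g []       = here refl
∈-boxes f≤g (a ∷ as) = ∈-cartesianProductWith⁺ _∷_ (∈-upTo⁺ (s≤s (f≤g a))) (∈-boxes f≤g as)

length-boxes : ∀ bs → length (boxes bs) ≡ product (map suc bs)
length-boxes []       = refl
length-boxes (b ∷ bs) = trans (length-cartesianProductWith _∷_ (upTo (suc b)) (boxes bs))
  (cong₂ _*_ (length-upTo (suc b)) (length-boxes bs))

smallSubsets : ∀ n → ℕ → List (Subset n)
smallSubsets zero    s       = [] ∷ []
smallSubsets (suc n) zero    = map (outside ∷_) (smallSubsets n zero)
smallSubsets (suc n) (suc s) =
  map (outside ∷_) (smallSubsets n (suc s)) ++ map (inside ∷_) (smallSubsets n s)

∈-smallSubsets : ∀ {n s} (p : Subset n) → ∣ p ∣ ≤ s → p ∈ smallSubsets n s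
∈-smallSubsets {s = zero}  []            _       = here refl
∈-smallSubsets {s = suc s} []            _       = here refl
∈-smallSubsets {s = zero}  (outside ∷ p) le      = ∈-map⁺ (outside ∷_) (∈-smallSubsets p le)
∈-smallSubsets {s = suc s} (outside ∷ p) le      =
  ∈-++⁺ˡ (∈-map⁺ (outside ∷_) (∈-smallSubsets p le))
∈-smallSubsets {suc n} {suc s} (inside ∷ p) (s≤s le) =
  ∈-++⁺ʳ (map (outside ∷_) (smallSubsets n (suc s))) (∈-map⁺ (inside ∷_) (∈-smallSubsets p le))

length-smallSubsets : ∀ n s → length (smallSubsets n s) ≤ suc n ^ s
length-smallSubsets zero    s       = m^n>0 1 s
length-smallSubsets (suc n) zero    =
  ≤-trans (≤-reflexive (length-map _ (smallSubsets n zero))) (length-smallSubsets n zero)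
length-smallSubsets (suc n) (suc s) = begin
  length (map (outside ∷_) (smallSubsets n (suc s)) ++ map (inside ∷_) (smallSubsets n s))
    ≡⟨ length-++ (map (outside ∷_) (smallSubsets n (suc s))) ⟩
  length (map (outside ∷_) (smallSubsets n (suc s))) + length (map (inside ∷_) (smallSubsets n s))
    ≡⟨ cong₂ _+_ (length-map _ (smallSubsets n (suc s))) (length-map _ (smallSubsets n s)) ⟩
  length (smallSubsets n (suc s)) + length (smallSubsets n s)
    ≤⟨ +-mono-≤ (length-smallSubsets n (suc s)) (length-smallSubsets n s) ⟩
  suc n ^ suc s + suc n ^ s
    ≡⟨ +-comm (suc n ^ suc s) (suc n ^ s) ⟩
  suc (suc n) * suc n ^ s
    ≤⟨ *-monoʳ-≤ (suc (suc n)) (^-monoˡ-≤ s (n≤1+n (suc n))) ⟩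
  suc (suc n) ^ suc s ∎
  where open ≤-Reasoning

elements : ∀ {n} → Subset n → List (Fin n)
elements []            = []
elements (outside ∷ p) = map suc (elements p)
elements (inside ∷ p)  = zero ∷ map suc (elements p)

length-elements : ∀ {n} (p : Subset n) → length (elements p) ≡ ∣ p ∣
length-elements []            = refl
length-elements (outside ∷ p) = trans (length-map suc (elements p)) (length-elements p)
length-elements (inside ∷ p)  = cong suc (trans (length-map suc (elements p)) (length-elements p))

∈-elements⁺ : ∀ {n} {p : Subset n} {v} → v ∈ₛ p → v ∈ elements p
∈-elements⁺ {p = inside ∷ p}  here      = here refl
∈-elements⁺ {p = inside ∷ p}  (there m) = there (∈-map⁺ suc (∈-elements⁺ m))
∈-elements⁺ {p = outside ∷ p} (there m) = ∈-map⁺ suc (∈-elements⁺ m)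

∈-elements⁻ : ∀ {n} (p : Subset n) {v} → v ∈ elements p → v ∈ₛ p
∈-elements⁻ (inside ∷ p)  (here refl) = here
∈-elements⁻ (inside ∷ p)  (there m) with _ , m′ , refl ← ∈-map⁻ suc m = there (∈-elements⁻ p m′)
∈-elements⁻ (outside ∷ p) m         with _ , m′ , refl ← ∈-map⁻ suc m = there (∈-elements⁻ p m′)

elements-unique : ∀ {n} (p : Subset n) → AllPairs _≢_ (elements p)
elements-unique []            = []
elements-unique (outside ∷ p) = AllPairs.map⁺ (AllPairs.map (_∘ Fin.suc-injective) (elements-unique p))
elements-unique (inside ∷ p)  =
  All.map⁺ (All.universal (λ _ ()) (elements p)) ∷
  AllPairs.map⁺ (AllPairs.map (_∘ Fin.suc-injective) (elements-unique p))

-- Counting in lists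

AllPairs-lookup : {A : Set} {R : A → A → Set} → Symmetric R → ∀ {xs} → AllPairs R xs →
  ∀ {x y} → x ∈ xs → y ∈ xs → x ≡ y ⊎ R x y
AllPairs-lookup R-sym (_ ∷ _)  (here refl) (here refl) = inj₁ refl
AllPairs-lookup R-sym (r ∷ _)  (here refl) (there y∈)  = inj₂ (All.lookup r y∈)
AllPairs-lookup R-sym (r ∷ _)  (there x∈)  (here refl) = inj₂ (R-sym (All.lookup r x∈))
AllPairs-lookup R-sym (_ ∷ rs) (there x∈)  (there y∈)  = AllPairs-lookup R-sym rs x∈ y∈

unique⇒length≤ : ∀ {n} {xs : List (Fin n)} → AllPairs _≢_ xs → length xs ≤ n
unique⇒length≤ {n} {xs} u = Fin.injective⇒≤ (lookup-inj u)
  where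
  lookup-inj : ∀ {ys : List (Fin n)} → AllPairs _≢_ ys →
    ∀ {i j} → lookup ys i ≡ lookup ys j → i ≡ j
  lookup-inj (_ ∷ _) {zero}  {zero}  _  = refl
  lookup-inj (r ∷ _) {zero}  {suc j} eq = contradiction eq (All.lookup r (∈-lookup j))
  lookup-inj (r ∷ _) {suc i} {zero}  eq = contradiction (sym eq) (All.lookup r (∈-lookup i))
  lookup-inj (_ ∷ u) {suc i} {suc j} eq = cong suc (lookup-inj u eq)

length-filter-complement : {A : Set} {P : A → Set} (P? : Decidable P) → ∀ xs →
  length (filter P? xs) + length (filter (λ x → ¬? (P? x)) xs) ≡ length xs
length-filter-complement P? []       = refl
length-filter-complement P? (x ∷ xs) with P? x
... | yes _ = cong suc (length-filter-complement P? xs)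
... | no  _ = trans (+-suc _ _) (cong suc (length-filter-complement P? xs))

length-filter≤1 : {A : Set} {P : A → Set} (P? : Decidable P) →
  (∀ {x y} → P x → P y → x ≡ y) → ∀ {xs} → AllPairs _≢_ xs → length (filter P? xs) ≤ 1
length-filter≤1 P? P-prop []              = z≤n
length-filter≤1 P? P-prop {x ∷ xs} (r ∷ u) with P? x
... | no  _  = length-filter≤1 P? P-prop u
... | yes px with filter P? xs in eq
...   | []     = s≤s z≤n
...   | y ∷ ys with y∈ , py ← ∈-filter⁻ P? {xs = xs} (subst (y ∈_) (sym eq) (here refl)) =
  contradiction (P-prop px py) (All.lookup r y∈)

map-≡-lookup : {A B : Set} {f g : A → B} → ∀ {xs x} → map f xs ≡ map g xs → x ∈ xs → f x ≡ g x
map-≡-lookup eq (here refl) = proj₁ (∷-injective eq)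
map-≡-lookup eq (there x∈)  = map-≡-lookup (proj₂ (∷-injective eq)) x∈

module Counting {A K : Set} (_≟_ : DecidableEquality K) (key : A → K) where

  fibre : K → List A → List A
  fibre t = filter (λ a → key a ≟ t)

  count : K → List A → ℕ
  count t as = length (fibre t as)

  count-↭ : ∀ t {as bs} → as ↭ bs → count t as ≡ count t bs
  count-↭ t p = ↭-length (filter-↭ (λ a → key a ≟ t) p)

  count-∷ : ∀ t {a b} as bs → key a ≡ key b → count t (a ∷ as) ≡ count t (b ∷ bs) →
    count t as ≡ count t bs
  count-∷ t {a} {b} as bs eq c with key a ≟ t | key b ≟ t
  ... | yes _ | yes _ = suc-injective c
  ... | no  _ | no  _ = c
  ... | yes p | no ¬q = contradiction (trans (sym eq) p) ¬q
  ... | no ¬p | yes q = contradiction (trans eq q) ¬p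

  count-∈ : ∀ t as {c} → count t as ≡ suc c → ∃ λ a → a ∈ as × key a ≡ t
  count-∈ t as eq with fibre t as in e
  ... | a ∷ _ = a , ∈-filter⁻ (λ a → key a ≟ t) (subst (a ∈_) (sym e) (here refl))

  count-self : ∀ a as → ∃ λ c → count (key a) (a ∷ as) ≡ suc c
  count-self a as = _ , cong length (filter-accept (λ b → key b ≟ key a) refl)

  count-absent : ∀ ts as → (∀ {a} → a ∈ as → key a ∈ ts) → ∀ {t} → t ∉ ts → count t as ≡ 0
  count-absent ts as as⊆ {t} t∉ = cong length (filter-none (λ a → key a ≟ t)
    (All.tabulate λ a∈ eq → t∉ (subst (_∈ ts) eq (as⊆ a∈))))

  -- Keys outside `ts` occur in neither list, so finitely many counts determine all of them.
  count-ext : ∀ ts as bs → (∀ {a} → a ∈ as → key a ∈ ts) → (∀ {b} → b ∈ bs → key b ∈ ts) →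
    map (λ t → count t as) ts ≡ map (λ t → count t bs) ts → ∀ t → count t as ≡ count t bs
  count-ext ts as bs as⊆ bs⊆ eq t with Any.any? (t ≟_) ts
  ... | yes t∈ = map-≡-lookup eq t∈
  ... | no  t∉ = trans (count-absent ts as as⊆ t∉) (sym (count-absent ts bs bs⊆ t∉))

  -- Greedy: the head of `as` takes any element of `bs` with its key, and removing both keeps all
  -- counts equal. This later turns equal signatures into a bijection between components.
  pairing : ∀ as bs → (∀ t → count t as ≡ count t bs) →
    ∃ λ ps → All (λ p → key (proj₁ p) ≡ key (proj₂ p)) ps ×
             map proj₁ ps ≡ as × map proj₂ ps ↭ bs
  pairing [] []       _  = [] , [] , refl , ↭-refl
  pairing [] (b ∷ bs) eq with _ , e ← count-self b bs = contradiction (trans (eq (key b)) e) λ ()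
  pairing (a ∷ as) bs eq
    with _ , e ← count-self a as
    with b , b∈bs , kb ← count-∈ (key a) bs (trans (sym (eq (key a))) e)
    with ys , zs , refl ← ∈-∃++ b∈bs
    with ps , same , fsts , snds ← pairing as (ys ++ zs) (λ t →
           count-∷ t as (ys ++ zs) (sym kb) (trans (eq t) (count-↭ t (shift b ys zs))))
    = (a , b) ∷ ps , sym kb ∷ same , cong (a ∷_) fsts ,
      ↭-trans (prep b snds) (↭-sym (shift b ys zs))

module Classes {A B : Set} (_≟_ : DecidableEquality B) (f : A → B) where

  class : A → List A → List A
  class r = filter (λ a → f a ≟ f r)

  reps : List A → List A
  reps []       = []
  reps (x ∷ xs) with Any.any? (λ r → f x ≟ f r) (reps xs)
  ... | yes _ = reps xs
  ... | no  _ = x ∷ reps xs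

  ∈-reps : ∀ {x xs} → x ∈ xs → ∃ λ r → r ∈ reps xs × f x ≡ f r
  ∈-reps {xs = x ∷ xs} x∈ with Any.any? (λ r → f x ≟ f r) (reps xs)
  ∈-reps (here refl) | yes p = find p
  ∈-reps (there x∈)  | yes _ = ∈-reps x∈
  ∈-reps (here refl) | no _  = _ , here refl , refl
  ∈-reps (there x∈)  | no _  with r , r∈ , eq ← ∈-reps x∈ = r , there r∈ , eq

  reps-distinct : ∀ xs → AllPairs (λ r s → f r ≢ f s) (reps xs)
  reps-distinct []       = []
  reps-distinct (x ∷ xs) with Any.any? (λ r → f x ≟ f r) (reps xs)
  ... | yes _ = reps-distinct xs
  ... | no ¬p = All.¬Any⇒All¬ (reps xs) ¬p ∷ reps-distinct xs

  class-remove-other : ∀ r s xs → f r ≢ f s →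
    class s (filter (λ a → ¬? (f a ≟ f r)) xs) ≡ class s xs
  class-remove-other r s []       _  = refl
  class-remove-other r s (x ∷ xs) r≢s with f x ≟ f r
  ... | yes x≡r = trans (class-remove-other r s xs r≢s)
                    (sym (filter-reject (λ a → f a ≟ f s) λ x≡s → r≢s (trans (sym x≡r) x≡s)))
  ... | no  _ with f x ≟ f s
  ...   | yes _ = cong (x ∷_) (class-remove-other r s xs r≢s)
  ...   | no  _ = class-remove-other r s xs r≢s

  -- Classes of different representatives are disjoint: removing the class of `r` leaves the others
  -- intact, so every representative uses up `q` elements of its own.
  count-large-classes : ∀ q rs xs → AllPairs (λ r s → f r ≢ f s) rs →
    All (λ r → q ≤ length (class r xs)) rs → length rs * q ≤ length xs
  count-large-classes q []       xs _       _         = z≤n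
  count-large-classes q (r ∷ rs) xs (d ∷ ds) (le ∷ les) = begin
    q + length rs * q
      ≤⟨ +-mono-≤ le (count-large-classes q rs rest ds
           (All.zipWith (λ {s} → λ (r≢s , l) →
              subst (λ c → q ≤ length c) (sym (class-remove-other r s xs r≢s)) l) (d , les))) ⟩
    length (class r xs) + length rest
      ≡⟨ length-filter-complement (λ a → f a ≟ f r) xs ⟩
    length xs ∎
    where
    open ≤-Reasoning
    rest = filter (λ a → ¬? (f a ≟ f r)) xs

-- Forests

-- Ordered rooted forests in first-child, next-sibling form, so that they are binary trees and need
-- no nested lists.
data Forest (A : Set) : Set where
  leaf : Forest A
  node : (a : A) (children siblings : Forest A) → Forest A

module _ {A : Set} where

  verts : Forest A → List A
  verts leaf           = []
  verts (node a cs ss) = a ∷ verts cs ++ verts ss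

  node-injective : ∀ {a b} {cs ss cs′ ss′ : Forest A} →
    _≡_ {A = Forest A} (node a cs ss) (node b cs′ ss′) → a ≡ b × cs ≡ cs′ × ss ≡ ss′
  node-injective refl = refl , refl , refl

  infixr 5 _⊕_
  _⊕_ : Forest A → Forest A → Forest A
  leaf         ⊕ H = H
  node a cs ss ⊕ H = node a cs (ss ⊕ H)

  verts-⊕ : ∀ F H → verts (F ⊕ H) ≡ verts F ++ verts H
  verts-⊕ leaf           H = refl
  verts-⊕ (node a cs ss) H = cong (a ∷_)
    (trans (cong (verts cs ++_) (verts-⊕ ss H)) (sym (++-assoc (verts cs) (verts ss) (verts H))))

  encode : Forest A → List (Maybe A)
  encode leaf           = nothing ∷ []
  encode (node a cs ss) = just a ∷ encode cs ++ encode ss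

  -- Codes are prefix-free. The remainders `xs` and `ys` carry the induction, because the code of
  -- the children is followed by that of the siblings.
  encode-prefix : ∀ F H {xs ys} → encode F ++ xs ≡ encode H ++ ys → F ≡ H × xs ≡ ys
  encode-prefix leaf           leaf             eq = refl , proj₂ (∷-injective eq)
  encode-prefix (node a cs ss) (node b cs′ ss′) {xs} {ys} eq
    with refl , eq₁ ← ∷-injective eq
    with refl , eq₂ ← encode-prefix cs cs′
           (trans (sym (++-assoc (encode cs) (encode ss) xs))
             (trans eq₁ (++-assoc (encode cs′) (encode ss′) ys)))
    with refl , eq₃ ← encode-prefix ss ss′ eq₂
    = refl , eq₃
  encode-prefix leaf         (node _ _ _) eq with () ← proj₁ (∷-injective eq)
  encode-prefix (node _ _ _) leaf         eq with () ← proj₁ (∷-injective eq)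

  encode-injective : ∀ {F H} → encode F ≡ encode H → F ≡ H
  encode-injective {F} {H} eq = proj₁ (encode-prefix F H (cong (_++ []) eq))

  -- A binary tree with s inner nodes has s + 1 leaves. This linear length is what limits the
  -- components with s vertices to 2 ^ O(s) codes.
  length-encode : ∀ F → length (encode F) ≡ suc (length (verts F) + length (verts F))
  length-encode leaf           = refl
  length-encode (node a cs ss) = cong suc (begin
    length (encode cs ++ encode ss)
      ≡⟨ length-++ (encode cs) ⟩
    length (encode cs) + length (encode ss)
      ≡⟨ cong₂ _+_ (length-encode cs) (length-encode ss) ⟩
    suc (l + l) + suc (r + r)
      ≡⟨ solve 2 (λ l r → (con 1 :+ (l :+ l)) :+ (con 1 :+ (r :+ r)) := (con 1 :+ (l :+ r)) :+ (con 1 :+ (l :+ r))) refl l r ⟩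
    suc (l + r) + suc (l + r)
      ≡⟨ cong (λ m → suc m + suc m) (sym (length-++ (verts cs))) ⟩
    suc (length (verts cs ++ verts ss)) + suc (length (verts cs ++ verts ss)) ∎)
    where
    open ≡-Reasoning
    open +-*-Solver
    l = length (verts cs)
    r = length (verts ss)

  module _ {P : A → Set} (P? : Decidable P) where

    -- The children of a removed vertex move up to its place, so ancestry among the kept vertices
    -- does not change.
    restrict : Forest A → Forest A
    restrict leaf = leaf
    restrict (node a cs ss) with P? a
    ... | yes _ = node a (restrict cs) (restrict ss)
    ... | no  _ = restrict cs ⊕ restrict ss

    verts-restrict : ∀ F → verts (restrict F) ≡ filter P? (verts F)
    verts-restrict leaf = refl
    verts-restrict (node a cs ss) with P? a
    ... | yes _ = cong (a ∷_) (trans (cong₂ _++_ (verts-restrict cs) (verts-restrict ss))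
                    (sym (filter-++ P? (verts cs) (verts ss))))
    ... | no  _ = trans (verts-⊕ (restrict cs) (restrict ss))
                    (trans (cong₂ _++_ (verts-restrict cs) (verts-restrict ss))
                      (sym (filter-++ P? (verts cs) (verts ss))))

    All-restrict : ∀ {Q : A → Set} F → All Q (verts F) → All Q (verts (restrict F))
    All-restrict F qs = subst (All _) (sym (verts-restrict F)) (All.filter⁺ P? qs)

  All-⊕ : ∀ {Q : A → Set} F H → All Q (verts F) → All Q (verts H) → All Q (verts (F ⊕ H))
  All-⊕ F H qs rs = subst (All _) (sym (verts-⊕ F H)) (All.++⁺ qs rs)

module _ {A B : Set} where

  -- Forests of different shape are silently truncated. Under equal annotations nothing is lost, as
  -- `zip-fst` and `zip-snd` confirm.
  zipF : Forest A → Forest B → List (A × B)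
  zipF (node a cs ss) (node b cs′ ss′) = (a , b) ∷ zipF cs cs′ ++ zipF ss ss′
  zipF _ _ = []

  All-zipF : ∀ {Q : A → Set} {R : B → Set} F H → All Q (verts F) → All R (verts H) →
    All (λ p → Q (proj₁ p) × R (proj₂ p)) (zipF F H)
  All-zipF leaf           _                qs       rs       = []
  All-zipF (node a cs ss) leaf             qs       rs       = []
  All-zipF (node a cs ss) (node b cs′ ss′) (q ∷ qs) (r ∷ rs)
    with qs₁ , qs₂ ← All.++⁻ (verts cs) qs
    with rs₁ , rs₂ ← All.++⁻ (verts cs′) rs
    = (q , r) ∷ All.++⁺ (All-zipF cs cs′ qs₁ rs₁) (All-zipF ss ss′ qs₂ rs₂)

module Matching {n : ℕ} (G : Graph n) where

  -- A list of pairwise `Matched` pairs is the graph of a partial isomorphism. As the condition is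
  -- binary, such lists can be concatenated after checking only the cross pairs.
  Matched : Fin n × Fin n → Fin n × Fin n → Set
  Matched (a , a′) (b , b′) = adj G a b ≡ adj G a′ b′ × a ≢ b × a′ ≢ b′

  Matched-sym : Symmetric Matched
  Matched-sym {a , a′} {b , b′} (eq , p , q) =
    trans (adj-sym G b a) (trans eq (adj-sym G a′ b′)) , p ∘ sym , q ∘ sym

-- Coloured elimination forests

-- The colour, then one bit per colour for adjacency to the nearest ancestor of that colour, then
-- the adjacencies to the separator.
Label : ℕ → Set
Label K = Fin K × List Bool × List Bool

module Elimination {n K : ℕ} (G : Graph n) (colour : Fin n → Fin K) where
  open Matching G

  Apart : Fin n → Fin n → Set
  Apart u w = u ≢ w × adj G u w ≡ false

  -- This makes v the nearest proper ancestor of its colour for every descendant adjacent to v.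
  data Shadowed (v : Fin n) : Forest (Fin n) → Set where
    leaf : Shadowed v leaf
    node : ∀ {w cs ss} → (colour w ≡ colour v → All (λ u → adj G v u ≡ false) (verts cs)) →
      Shadowed v cs → Shadowed v ss → Shadowed v (node w cs ss)

  -- Every edge joins an ancestor to a descendant, no vertex occurs twice, and each vertex is
  -- shadowed in the forest below it.
  data Valid : Forest (Fin n) → Set where
    leaf : Valid leaf
    node : ∀ {v cs ss} → All (Apart v) (verts ss) → All (v ≢_) (verts cs) →
      All (λ w → All (Apart w) (verts ss)) (verts cs) →
      Shadowed v cs → Valid cs → Valid ss → Valid (node v cs ss)

  Valid⇒unique : ∀ {F} → Valid F → AllPairs _≢_ (verts F)
  Valid⇒unique leaf = []
  Valid⇒unique (node v-ss v-cs cs-ss _ vcs vss) =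
    All.++⁺ v-cs (All.map proj₁ v-ss) ∷
    AllPairs.++⁺ (Valid⇒unique vcs) (Valid⇒unique vss) (All.map (All.map proj₁) cs-ss)

  Shadowed-nonadjacent : ∀ {v} F → All (λ u → adj G v u ≡ false) (verts F) → Shadowed v F
  Shadowed-nonadjacent leaf           _        = leaf
  Shadowed-nonadjacent (node w cs ss) (_ ∷ ns) with ns₁ , ns₂ ← All.++⁻ (verts cs) ns =
    node (λ _ → ns₁) (Shadowed-nonadjacent cs ns₁) (Shadowed-nonadjacent ss ns₂)

  Shadowed-⊕ : ∀ {v F H} → Shadowed v F → Shadowed v H → Shadowed v (F ⊕ H)
  Shadowed-⊕ leaf             sH = sH
  Shadowed-⊕ (node q scs sss) sH = node q scs (Shadowed-⊕ sss sH)

  Valid-⊕ : ∀ {F H} → Valid F → Valid H → All (λ w → All (Apart w) (verts H)) (verts F) →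
    Valid (F ⊕ H)
  Valid-⊕ leaf vH _ = vH
  Valid-⊕ {node v cs ss} {H} (node v-ss v-cs cs-ss sh vcs vss) vH (v-H ∷ F-H)
    with cs-H , ss-H ← All.++⁻ (verts cs) F-H =
    node (All-⊕ ss H v-ss v-H) v-cs
      (All.zipWith (λ (a , b) → All-⊕ ss H a b) (cs-ss , cs-H)) sh vcs (Valid-⊕ vss vH ss-H)

  module _ {P : Fin n → Set} (P? : Decidable P) where

    Shadowed-restrict : ∀ {v F} → Shadowed v F → Shadowed v (restrict P? F)
    Shadowed-restrict leaf = leaf
    Shadowed-restrict {F = node w cs ss} (node q scs sss) with P? w
    ... | yes _ = node (All-restrict P? cs ∘ q) (Shadowed-restrict scs) (Shadowed-restrict sss)
    ... | no  _ = Shadowed-⊕ (Shadowed-restrict scs) (Shadowed-restrict sss)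

    -- When `v` is removed, its descendants become neighbours in the list of siblings `ss`; the
    -- apartness needed then is already stored in `cs-ss`.
    Valid-restrict : ∀ {F} → Valid F → Valid (restrict P? F)
    Valid-restrict leaf = leaf
    Valid-restrict {node v cs ss} (node v-ss v-cs cs-ss sh vcs vss) with P? v
    ... | yes _ = node (All-restrict P? ss v-ss) (All-restrict P? cs v-cs)
                    (All-restrict P? cs (All.map (All-restrict P? ss) cs-ss))
                    (Shadowed-restrict sh) (Valid-restrict vcs) (Valid-restrict vss)
    ... | no  _ = Valid-⊕ (Valid-restrict vcs) (Valid-restrict vss)
                    (All-restrict P? cs (All.map (All-restrict P? ss) cs-ss))

  -- An environment records, for each colour, the adjacency row of the nearest ancestor of that colour.
  Env : Set
  Env = Fin K → Fin n → Bool

  push : Env → Fin n → Env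
  push e v j with j Fin.≟ colour v
  ... | yes _ = adj G v
  ... | no  _ = e j

  push-same : ∀ e v w → push e v (colour v) w ≡ adj G v w
  push-same e v w with colour v Fin.≟ colour v
  ... | yes _ = refl
  ... | no ¬p = contradiction refl ¬p

  push-other : ∀ e v j w → colour v ≢ j → push e v j w ≡ e j w
  push-other e v j w v≢j with j Fin.≟ colour v
  ... | yes p = contradiction (sym p) v≢j
  ... | no  _ = refl

  module Annotation (mark : Fin n → List Bool) where

    label : Env → Fin n → Label K
    label e v = colour v , map (λ j → e j v) (allFin K) , mark v

    annotate : Env → Forest (Fin n) → Forest (Label K)
    annotate e leaf           = leaf
    annotate e (node v cs ss) = node (label e v) (annotate (push e v) cs) (annotate e ss)

    verts-annotate : ∀ e F → length (verts (annotate e F)) ≡ length (verts F)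
    verts-annotate e leaf           = refl
    verts-annotate e (node v cs ss) = cong suc (trans (length-++ (verts (annotate (push e v) cs)))
      (trans (cong₂ _+_ (verts-annotate _ cs) (verts-annotate e ss)) (sym (length-++ (verts cs)))))

    zip-fst : ∀ {e e′} F F′ → annotate e F ≡ annotate e′ F′ → map proj₁ (zipF F F′) ≡ verts F
    zip-fst leaf           leaf              eq = refl
    zip-fst (node v cs ss) (node v′ cs′ ss′) eq with _ , eq₁ , eq₂ ← node-injective eq =
      cong (v ∷_) (trans (map-++ proj₁ (zipF cs cs′) (zipF ss ss′))
        (cong₂ _++_ (zip-fst cs cs′ eq₁) (zip-fst ss ss′ eq₂)))

    zip-snd : ∀ {e e′} F F′ → annotate e F ≡ annotate e′ F′ → map proj₂ (zipF F F′) ≡ verts F′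
    zip-snd leaf           leaf              eq = refl
    zip-snd (node v cs ss) (node v′ cs′ ss′) eq with _ , eq₁ , eq₂ ← node-injective eq =
      cong (v′ ∷_) (trans (map-++ proj₂ (zipF cs cs′) (zipF ss ss′))
        (cong₂ _++_ (zip-snd cs cs′ eq₁) (zip-snd ss ss′ eq₂)))

    zip-mark : ∀ {e e′} F F′ → annotate e F ≡ annotate e′ F′ →
      All (λ p → mark (proj₁ p) ≡ mark (proj₂ p)) (zipF F F′)
    zip-mark leaf           leaf              eq = []
    zip-mark (node v cs ss) (node v′ cs′ ss′) eq with l , eq₁ , eq₂ ← node-injective eq =
      cong (proj₂ ∘ proj₂) l ∷ All.++⁺ (zip-mark cs cs′ eq₁) (zip-mark ss ss′ eq₂)

    Apart⇒Matched : ∀ {a a′ b b′} → Apart a b × Apart a′ b′ → Matched (a , a′) (b , b′)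
    Apart⇒Matched ((p , eq) , (p′ , eq′)) = trans eq (sym eq′) , p , p′

    -- Until a vertex of the colour of `v` is met, the environment holds the row of `v` at that
    -- colour, so the labels reveal adjacency to `v`. Below such a vertex `Shadowed` excludes
    -- adjacency. Equal labels make this switch happen at the same place in both forests.
    zip-adj : ∀ {e e′} F F′ → annotate e F ≡ annotate e′ F′ →
      ∀ {v v′} → colour v ≡ colour v′ → Shadowed v F → Shadowed v′ F′ →
      (∀ w → e (colour v) w ≡ adj G v w) → (∀ w → e′ (colour v) w ≡ adj G v′ w) →
      All (λ p → adj G v (proj₁ p) ≡ adj G v′ (proj₂ p)) (zipF F F′)
    zip-adj leaf leaf _ _ _ _ _ _ = []
    zip-adj {e} {e′} (node w cs ss) (node w′ cs′ ss′) eq {v} {v′} cv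
      (node q scs sss) (node q′ scs′ sss′) ev ev′
      with l , eq₁ , eq₂ ← node-injective eq =
      -- The label bit at the colour of `v` is adjacency to `v` on one side and to `v′` on the
      -- other.
      trans (sym (ev w)) (trans (map-≡-lookup (cong (proj₁ ∘ proj₂) l) (∈-allFin (colour v))) (ev′ w′)) ∷
      All.++⁺ below (zip-adj ss ss′ eq₂ cv sss sss′ ev ev′)
      where
      below : All (λ p → adj G v (proj₁ p) ≡ adj G v′ (proj₂ p)) (zipF cs cs′)
      below with colour w Fin.≟ colour v
      ... | yes cw = All.map (λ (a , b) → trans a (sym b))
              (All-zipF cs cs′ (q cw) (q′ (trans (sym (cong proj₁ l)) (trans cw cv))))
      ... | no ¬cw = zip-adj cs cs′ eq₁ cv scs scs′
              (λ u → trans (push-other e w _ u ¬cw) (ev u))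
              (λ u → trans (push-other e′ w′ _ u (¬cw ∘ trans (cong proj₁ l))) (ev′ u))

    -- An ancestor and a descendant are compared by `zip-adj`; unrelated vertices are nonadjacent on
    -- both sides.
    zip-matched : ∀ {e e′} F F′ → annotate e F ≡ annotate e′ F′ → Valid F → Valid F′ →
      AllPairs Matched (zipF F F′)
    zip-matched leaf leaf _ _ _ = []
    zip-matched {e} {e′} (node v cs ss) (node v′ cs′ ss′) eq
      (node v-ss v-cs cs-ss sh vcs vss) (node v-ss′ v-cs′ cs-ss′ sh′ vcs′ vss′)
      with l , eq₁ , eq₂ ← node-injective eq =
      All.++⁺
        (All.zipWith (λ (a , b , c) → a , b , c)
          (zip-adj cs cs′ eq₁ cv sh sh′ (push-same e v)
             (λ w → trans (cong (λ j → push e′ v′ j w) cv) (push-same e′ v′ w)) ,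
           All-zipF cs cs′ v-cs v-cs′))
        (All.map Apart⇒Matched (All-zipF ss ss′ v-ss v-ss′)) ∷
      AllPairs.++⁺ (zip-matched cs cs′ eq₁ vcs vcs′) (zip-matched ss ss′ eq₂ vss vss′)
        (All.map (λ (a , b) → All.map Apart⇒Matched (All-zipF ss ss′ a b))
          (All-zipF cs cs′ cs-ss cs-ss′))
      where
      cv : colour v ≡ colour v′
      cv = cong proj₁ (proj₁ (node-injective eq))

-- Bag sequences

-- A rooted tree decomposition, built bag by bag with the newest bag first. A vertex is introduced
-- once, by `grow`, and reaches other bags only through `branch`; freshness in `grow` thus replaces
-- the condition that the bags of a vertex form a subtree.
data BagSequence {n : ℕ} (K : ℕ) : (m : ℕ) → (Fin m → List (Fin n)) → Set where
  root   : BagSequence K 1 ([] ◂ λ ())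
  branch : ∀ {m b} → BagSequence K m b → (p : Fin m) → ∀ B → (∀ {v} → v ∈ B → v ∈ b p) →
    BagSequence K (suc m) (B ◂ b)
  grow   : ∀ {m B b} v → BagSequence K (suc m) (B ◂ b) → v ∉ B → (∀ i → v ∉ b i) →
    length B < K → BagSequence K (suc m) ((v ∷ B) ◂ b)

grow* : ∀ {n K m} {B : List (Fin n)} {b} → BagSequence K (suc m) (B ◂ b) → ∀ vs →
  AllPairs _≢_ vs → All (_∉ B) vs → All (λ v → ∀ i → v ∉ b i) vs → length vs + length B ≤ K →
  BagSequence K (suc m) ((vs ++ B) ◂ b)
grow* s []       _         _          _          _  = s
grow* {B = B} s (v ∷ vs) (v≢ ∷ u) (v∉B ∷ vs∉B) (v∉b ∷ vs∉b) le =
  grow v (grow* s vs u vs∉B vs∉b (<⇒≤ le))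
    (λ v∈ → [ (λ v∈vs → All.lookup v≢ v∈vs refl) , v∉B ]′ (∈-++⁻ vs v∈)) v∉b
    (subst (_< _) (sym (length-++ vs)) le)

-- Otherwise the positions of the colours in `js` would inject `Fin K` into a smaller set.
unused : ∀ {K} (js : List (Fin K)) → length js < K → ∃ λ j → j ∉ js
unused js lt = Fin.¬∀⟶∃¬ _ (_∈ js) (λ j → Any.any? (j Fin.≟_) js) λ all∈ →
  <⇒≱ lt (Fin.injective⇒≤ {f = λ j → Any.index (all∈ j)} λ {i} {j} eq →
    trans (Any.lookup-index (all∈ i)) (trans (cong (lookup js) eq) (sym (Any.lookup-index (all∈ j)))))

InjectiveOn : {A B : Set} → (A → B) → List A → Set
InjectiveOn f xs = ∀ {u v} → u ∈ xs → v ∈ xs → f u ≡ f v → u ≡ v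

module _ {n k : ℕ} where

  recolour : (Fin n → Fin (suc k)) → Fin n → Fin (suc k) → Fin n → Fin (suc k)
  recolour c v j u with u Fin.≟ v
  ... | yes _ = j
  ... | no  _ = c u

  recolour-injectiveOn : ∀ {c v j B} → v ∉ B → InjectiveOn c B → InjectiveOn (recolour c v j) B
  recolour-injectiveOn {v = v} v∉B inj {x} {y} x∈ y∈ eq with x Fin.≟ v | y Fin.≟ v
  ... | yes refl | _        = contradiction x∈ v∉B
  ... | no _     | yes refl = contradiction y∈ v∉B
  ... | no _     | no _     = inj x∈ y∈ eq

  recolour-injectiveOn-∷ : ∀ {c v j B} → j ∉ map c B → v ∉ B → InjectiveOn c B →
    InjectiveOn (recolour c v j) (v ∷ B)
  recolour-injectiveOn-∷ {c} {v} j∉ v∉B inj {x} {y} x∈ y∈ eq with x Fin.≟ v | y Fin.≟ v | x∈ | y∈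
  ... | yes refl | yes refl | _         | _         = refl
  ... | yes refl | no y≢v   | _         | here p    = contradiction p y≢v
  ... | yes refl | no _     | _         | there y∈B =
    contradiction (subst (_∈ _) (sym eq) (∈-map⁺ c y∈B)) j∉
  ... | no x≢v   | yes refl | here p    | _         = contradiction p x≢v
  ... | no _     | yes refl | there x∈B | _         =
    contradiction (subst (_∈ _) eq (∈-map⁺ c x∈B)) j∉
  ... | no x≢v   | no _     | here p    | _         = contradiction p x≢v
  ... | no _     | no y≢v   | there _   | here p    = contradiction p y≢v
  ... | no _     | no _     | there x∈B | there y∈B = inj x∈B y∈B eq

  -- Greedy: the bag that `v` enters has at most `k` vertices, so one of the `suc k` colours is free
  -- there. Since `v` is in no other bag at that moment, recolouring it disturbs nothing.
  colouring : ∀ {m} {b : Fin m → List (Fin n)} → BagSequence (suc k) m b →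
    ∃ λ (c : Fin n → Fin (suc k)) → ∀ i → InjectiveOn c (b i)
  colouring root = (λ _ → zero) , λ { zero () }
  colouring (branch s p B B⊆) with c , inj ← colouring s =
    c , λ { zero x∈ y∈ → inj p (B⊆ x∈) (B⊆ y∈) ; (suc i) → inj i }
  colouring (grow {B = B} v s v∉B v∉b lt)
    with c , inj ← colouring s
    with j , j∉ ← unused (map c B) (subst (_< _) (sym (length-map c B)) lt) =
    recolour c v j , λ { zero    → recolour-injectiveOn-∷ j∉ v∉B (inj zero)
                       ; (suc i) → recolour-injectiveOn (v∉b i) (inj (suc i)) }

-- The elimination forest of a bag sequence

nonadjacent : ∀ {n} (G : Graph n) {u v} → ¬ Edge G u v → adj G u v ≡ false
nonadjacent G = Bool.¬-not

module _ {n k : ℕ} (G : Graph n) (colour : Fin n → Fin (suc k)) where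
  open Elimination G colour

  -- Undoing the sequence step by step, F i collects the eliminated vertices hanging below bag i.
  record Hanging {m : ℕ} (b : Fin m → List (Fin n)) (F : Fin m → Forest (Fin n)) : Set where
    field
      injective : ∀ i → InjectiveOn colour (b i)
      valid     : ∀ i → Valid (F i)
      shadowed  : ∀ i {u} → u ∈ b i → Shadowed u (F i)
      closed    : ∀ i {w u} → w ∈ verts (F i) → Edge G w u → u ∈ b i ⊎ u ∈ verts (F i)
      fresh     : ∀ i j {w} → w ∈ verts (F i) → w ∉ b j
      disjoint  : ∀ {i j w} → w ∈ verts (F i) → w ∈ verts (F j) → i ≡ j
      edge      : ∀ {u v i j} → u ∈ b i → v ∈ b j → Edge G u v → ∃ λ l → u ∈ b l × v ∈ b l
      cover     : ∀ v → (∃ λ i → v ∈ b i) ⊎ (∃ λ i → v ∈ verts (F i))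

  module _ {m : ℕ} {b : Fin m → List (Fin n)} {B : List (Fin n)} {F : Fin (suc m) → Forest (Fin n)}
           (p : Fin m) (B⊆ : ∀ {v} → v ∈ B → v ∈ b p) (h : Hanging (B ◂ b) F) where
    open Hanging h

    merged : Fin m → Forest (Fin n)
    merged i with i Fin.≟ p
    ... | yes _ = F (suc i) ⊕ F zero
    ... | no  _ = F (suc i)

    merged-from : ∀ i {w} → w ∈ verts (merged i) → w ∈ verts (F (suc i)) ⊎ (w ∈ verts (F zero) × i ≡ p)
    merged-from i w∈ with i Fin.≟ p
    ... | no  _  = inj₁ w∈
    ... | yes eq with ∈-++⁻ (verts (F (suc i))) (subst (_ ∈_) (verts-⊕ (F (suc i)) (F zero)) w∈)
    ...   | inj₁ q = inj₁ q
    ...   | inj₂ q = inj₂ (q , eq)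

    merged-to : ∀ i {w} → w ∈ verts (F (suc i)) → w ∈ verts (merged i)
    merged-to i w∈ with i Fin.≟ p
    ... | no  _ = w∈
    ... | yes _ = subst (_ ∈_) (sym (verts-⊕ (F (suc i)) (F zero))) (∈-++⁺ˡ w∈)

    merged-to₀ : ∀ {w} → w ∈ verts (F zero) → w ∈ verts (merged p)
    merged-to₀ w∈ with p Fin.≟ p
    ... | no ¬p = contradiction refl ¬p
    ... | yes _ = subst (_ ∈_) (sym (verts-⊕ (F (suc p)) (F zero))) (∈-++⁺ʳ (verts (F (suc p))) w∈)

    suc-zero-disjoint : ∀ {i w} → w ∈ verts (F (suc i)) → w ∉ verts (F zero)
    suc-zero-disjoint w∈ w∈′ with () ← disjoint w∈ w∈′

    -- Undoes `branch` by handing the forest of the dropped bag to bag `p`. As `B` is part of `b p`,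
    -- that bag still contains all outside neighbours of the forest. Vertices of `b p` outside `B`
    -- have no neighbour in it, hence shadow it trivially.
    hanging-merged : Hanging b merged
    hanging-merged = record
      { injective = λ i → injective (suc i)
      ; valid     = valid′
      ; shadowed  = shadowed′
      ; closed    = closed′
      ; fresh     = λ i j w∈ → [ fresh (suc i) (suc j) , (λ (w∈₀ , _) → fresh zero (suc j) w∈₀) ]′ (merged-from i w∈)
      ; disjoint  = λ {i} {j} w∈ w∈′ → disjoint′ (merged-from i w∈) (merged-from j w∈′)
      ; edge      = λ {u} {v} {i} {j} u∈ v∈ e → edge′ (edge {i = suc i} {j = suc j} u∈ v∈ e)
      ; cover     = λ v → cover′ (cover v)
      }
      where
      valid′ : ∀ i → Valid (merged i)
      valid′ i with i Fin.≟ p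
      ... | no  _    = valid (suc i)
      ... | yes refl = Valid-⊕ (valid (suc p)) (valid zero)
        (All.tabulate λ w∈ → All.tabulate λ u∈ →
          (λ { refl → suc-zero-disjoint w∈ u∈ }) ,
          nonadjacent G λ e → [ fresh zero (suc p) u∈ , (λ u∈′ → suc-zero-disjoint u∈′ u∈) ]′ (closed (suc p) w∈ e))

      shadowed′ : ∀ i {u} → u ∈ b i → Shadowed u (merged i)
      shadowed′ i {u} u∈ with i Fin.≟ p
      ... | no  _    = shadowed (suc i) u∈
      ... | yes refl with Any.any? (u Fin.≟_) B
      ...   | yes u∈B = Shadowed-⊕ (shadowed (suc p) u∈) (shadowed zero u∈B)
      ...   | no  u∉B = Shadowed-⊕ (shadowed (suc p) u∈) (Shadowed-nonadjacent (F zero)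
        (All.tabulate λ {w} w∈ → nonadjacent G λ e →
          [ u∉B , (λ u∈₀ → fresh zero (suc p) u∈₀ u∈) ]′ (closed zero w∈ (trans (adj-sym G w u) e))))

      closed′ : ∀ i {w u} → w ∈ verts (merged i) → Edge G w u → u ∈ b i ⊎ u ∈ verts (merged i)
      closed′ i w∈ e with merged-from i w∈
      ... | inj₁ q = [ inj₁ , inj₂ ∘ merged-to i ]′ (closed (suc i) q e)
      ... | inj₂ (q , refl) = [ inj₁ ∘ B⊆ , inj₂ ∘ merged-to₀ ]′ (closed zero q e)

      disjoint′ : ∀ {i j w} → w ∈ verts (F (suc i)) ⊎ (w ∈ verts (F zero) × i ≡ p) →
        w ∈ verts (F (suc j)) ⊎ (w ∈ verts (F zero) × j ≡ p) → i ≡ j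
      disjoint′ (inj₁ x)          (inj₁ y)          = Fin.suc-injective (disjoint x y)
      disjoint′ (inj₁ x)          (inj₂ (y , _))    = contradiction y (suc-zero-disjoint x)
      disjoint′ (inj₂ (x , _))    (inj₁ y)          = contradiction x (suc-zero-disjoint y)
      disjoint′ (inj₂ (_ , refl)) (inj₂ (_ , refl)) = refl

      edge′ : ∀ {u v} → (∃ λ l → u ∈ (B ◂ b) l × v ∈ (B ◂ b) l) → ∃ λ l → u ∈ b l × v ∈ b l
      edge′ (zero  , u∈ , v∈) = p , B⊆ u∈ , B⊆ v∈
      edge′ (suc l , u∈ , v∈) = l , u∈ , v∈

      cover′ : ∀ {v} → (∃ λ i → v ∈ (B ◂ b) i) ⊎ (∃ λ i → v ∈ verts (F i)) →
        (∃ λ i → v ∈ b i) ⊎ (∃ λ i → v ∈ verts (merged i))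
      cover′ (inj₁ (zero  , v∈)) = inj₁ (p , B⊆ v∈)
      cover′ (inj₁ (suc i , v∈)) = inj₁ (i , v∈)
      cover′ (inj₂ (zero  , v∈)) = inj₂ (p , merged-to₀ v∈)
      cover′ (inj₂ (suc i , v∈)) = inj₂ (i , merged-to i v∈)

  module _ {m : ℕ} {b : Fin m → List (Fin n)} {B : List (Fin n)} {F : Fin (suc m) → Forest (Fin n)}
           (v : Fin n) (v∉B : v ∉ B) (v∉b : ∀ i → v ∉ b i) (h : Hanging ((v ∷ B) ◂ b) F) where
    open Hanging h

    lowered : Fin (suc m) → Forest (Fin n)
    lowered = node v (F zero) leaf ◂ (F ∘ suc)

    lowered-from : ∀ i {w} → w ∈ verts (lowered i) → (w ≡ v × i ≡ zero) ⊎ w ∈ verts (F i)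
    lowered-from zero    (here eq)  = inj₁ (eq , refl)
    lowered-from zero    (there w∈) = inj₂ (subst (_ ∈_) (++-identityʳ (verts (F zero))) w∈)
    lowered-from (suc i) w∈         = inj₂ w∈

    lowered-to : ∀ i {w} → w ∈ verts (F i) → w ∈ verts (lowered i)
    lowered-to zero    w∈ = there (∈-++⁺ˡ w∈)
    lowered-to (suc i) w∈ = w∈

    bag-to : ∀ i {u} → u ∈ (B ◂ b) i → u ∈ ((v ∷ B) ◂ b) i
    bag-to zero    u∈ = there u∈
    bag-to (suc i) u∈ = u∈

    bag-from : ∀ i {u} → u ∈ ((v ∷ B) ◂ b) i → (u ≡ v × i ≡ zero) ⊎ u ∈ (B ◂ b) i
    bag-from zero    (here eq)  = inj₁ (eq , refl)
    bag-from zero    (there u∈) = inj₂ u∈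
    bag-from (suc i) u∈         = inj₂ u∈

    v∉bags : ∀ i → v ∉ (B ◂ b) i
    v∉bags zero    = v∉B
    v∉bags (suc i) = v∉b i

    v∉forests : ∀ i → v ∉ verts (F i)
    v∉forests i v∈ = fresh i zero v∈ (here refl)

    -- Only bag `zero` contains `v`. A neighbour that is still in a bag shares that one with `v`; an
    -- eliminated neighbour lies in a forest whose bag contains `v`, which must be `F zero`.
    neighbour-of-v : ∀ {u} → Edge G v u → u ∈ B ⊎ u ∈ verts (F zero)
    neighbour-of-v {u} e with cover u
    ... | inj₂ (i , u∈) with closed i u∈ (trans (adj-sym G u v) e)
    ...   | inj₂ v∈ = contradiction v∈ (v∉forests i)
    ...   | inj₁ v∈ with bag-from i v∈
    ...     | inj₁ (_ , refl) = inj₂ u∈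
    ...     | inj₂ v∈′        = contradiction v∈′ (v∉bags i)
    neighbour-of-v {u} e | inj₁ (i , u∈) with edge {i = zero} {j = i} (here refl) u∈ e
    ... | l , v∈ , u∈′ with bag-from l v∈
    ...   | inj₂ v∈′ = contradiction v∈′ (v∉bags l)
    ...   | inj₁ (_ , refl) with u∈′
    ...     | there u∈B = inj₁ u∈B
    ...     | here refl with () ← trans (sym e) (adj-irrefl G v)

    -- Undoes `grow` by making `v` the root above everything that hangs below its bag.
    hanging-lowered : Hanging (B ◂ b) lowered
    hanging-lowered = record
      { injective = λ i x∈ y∈ → injective i (bag-to i x∈) (bag-to i y∈)
      ; valid     = λ { zero    → node [] (All.tabulate λ { w∈ refl → v∉forests zero w∈ })
                                    (All.tabulate λ _ → []) (shadowed zero (here refl)) (valid zero) leaf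
                      ; (suc i) → valid (suc i) }
      -- The colours in the bag are distinct, so `v` never has the colour of a remaining `u`, and
      -- the condition at the new node is vacuous.
      ; shadowed  = λ { zero    u∈ → node
                          (λ eq → contradiction (subst (_∈ B) (sym (injective zero (here refl) (there u∈) eq)) u∈) v∉B)
                          (shadowed zero (there u∈)) leaf
                      ; (suc i) u∈ → shadowed (suc i) u∈ }
      ; closed    = closed′
      ; fresh     = λ i j w∈ w∈′ → fresh′ j (lowered-from i w∈) w∈′
      ; disjoint  = λ {i} {j} w∈ w∈′ → disjoint′ (lowered-from i w∈) (lowered-from j w∈′)
      ; edge      = λ {_} {_} {i} {j} x∈ y∈ e → edge′ {i} {j} x∈ y∈ (edge {i = i} {j = j} (bag-to i x∈) (bag-to j y∈) e)
      ; cover     = λ u → cover′ (cover u)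
      }
      where
      closed′ : ∀ i {w u} → w ∈ verts (lowered i) → Edge G w u → u ∈ (B ◂ b) i ⊎ u ∈ verts (lowered i)
      closed′ i w∈ e with lowered-from i w∈
      ... | inj₁ (refl , refl) = [ inj₁ , inj₂ ∘ lowered-to zero ]′ (neighbour-of-v e)
      ... | inj₂ q with closed i q e
      ...   | inj₂ u∈ = inj₂ (lowered-to i u∈)
      ...   | inj₁ u∈ with bag-from i u∈
      ...     | inj₁ (refl , refl) = inj₂ (here refl)
      ...     | inj₂ u∈′           = inj₁ u∈′

      fresh′ : ∀ {i} j {w} → (w ≡ v × i ≡ zero) ⊎ w ∈ verts (F i) → w ∉ (B ◂ b) j
      fresh′ j (inj₁ (refl , _)) = v∉bags j
      fresh′ {i} j (inj₂ w∈)     = fresh i j w∈ ∘ bag-to j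

      disjoint′ : ∀ {i j w} → (w ≡ v × i ≡ zero) ⊎ w ∈ verts (F i) →
        (w ≡ v × j ≡ zero) ⊎ w ∈ verts (F j) → i ≡ j
      disjoint′ (inj₁ (_ , refl)) (inj₁ (_ , refl)) = refl
      disjoint′ {j = j} (inj₁ (refl , _)) (inj₂ y)  = contradiction y (v∉forests j)
      disjoint′ {i} (inj₂ x) (inj₁ (refl , _))      = contradiction x (v∉forests i)
      disjoint′ (inj₂ x) (inj₂ y)                   = disjoint x y

      edge′ : ∀ {i j x y} → x ∈ (B ◂ b) i → y ∈ (B ◂ b) j →
        (∃ λ l → x ∈ ((v ∷ B) ◂ b) l × y ∈ ((v ∷ B) ◂ b) l) → ∃ λ l → x ∈ (B ◂ b) l × y ∈ (B ◂ b) l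
      edge′ {i} {j} x∈ y∈ (l , x∈′ , y∈′) with bag-from l x∈′ | bag-from l y∈′
      ... | inj₂ p          | inj₂ q          = l , p , q
      ... | inj₁ (refl , _) | _               = contradiction x∈ (v∉bags i)
      ... | inj₂ _          | inj₁ (refl , _) = contradiction y∈ (v∉bags j)

      cover′ : ∀ {u} → (∃ λ i → u ∈ ((v ∷ B) ◂ b) i) ⊎ (∃ λ i → u ∈ verts (F i)) →
        (∃ λ i → u ∈ (B ◂ b) i) ⊎ (∃ λ i → u ∈ verts (lowered i))
      cover′ (inj₂ (i , u∈)) = inj₂ (i , lowered-to i u∈)
      cover′ (inj₁ (i , u∈)) with bag-from i u∈
      ... | inj₁ (refl , _) = inj₂ (zero , here refl)
      ... | inj₂ u∈′        = inj₁ (i , u∈′)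

  eliminate : ∀ {m b F} → BagSequence (suc k) m b → Hanging b F →
    ∃ λ H → Valid H × (∀ v → v ∈ verts H)
  -- The last bag is empty, so every vertex has been eliminated.
  eliminate {F = F} root h = F zero , valid zero , all∈
    where
    open Hanging h
    all∈ : ∀ v → v ∈ verts (F zero)
    all∈ v with cover v
    ... | inj₁ (zero , ())
    ... | inj₂ (zero , v∈) = v∈
  eliminate (branch s p B B⊆)      h = eliminate s (hanging-merged p B⊆ h)
  eliminate (grow v s v∉B v∉b _)   h = eliminate s (hanging-lowered v v∉B v∉b h)

-- Walks in trees and exploration of a tree decomposition

module _ {n : ℕ} {G : Graph n} where

  walk-map : ∀ {P Q : Fin n → Set} → (∀ {x} → P x → Q x) → ∀ {u v} → WalkIn G P u v → WalkIn G Q u v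
  walk-map f (here p)     = here (f p)
  walk-map f (step p e w) = step (f p) e (walk-map f w)

  walk-++ : ∀ {P : Fin n → Set} {u v w} → WalkIn G P u v → WalkIn G P v w → WalkIn G P u w
  walk-++ (here _)     q = q
  walk-++ (step p e w) q = step p e (walk-++ w q)

  walk-end : ∀ {P : Fin n → Set} {u v} → WalkIn G P u v → P v
  walk-end (here p)     = p
  walk-end (step _ _ w) = walk-end w

  -- Cuts the walk at its first visit to `p`.
  walk-before : ∀ {P : Fin n → Set} {u p} → u ≢ p → WalkIn G P u p →
    ∃ λ y → Edge G y p × WalkIn G (λ x → P x × x ≢ p) u y
  walk-before u≢p (here _) = contradiction refl u≢p
  walk-before {u = u} {p} u≢p (step {w = w} Pu e walk) with w Fin.≟ p
  ... | yes refl = u , e , here (Pu , u≢p)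
  ... | no w≢p with y , e′ , walk′ ← walk-before w≢p walk = y , e′ , step (Pu , u≢p) e walk′

  data Path (P : Fin n → Set) : Fin n → Fin n → List (Fin n) → Set where
    stop : ∀ {x} → P x → Path P x x []
    cons : ∀ {x w y us} → P x → Edge G x w → All (x ≢_) (w ∷ us) → Path P w y us →
      Path P x y (w ∷ us)

  module _ {P : Fin n → Set} where

    path-suffix : ∀ {w y us x} → Path P w y us → x ∈ (w ∷ us) → ∃ λ us′ → Path P x y us′
    path-suffix p              (here refl) = _ , p
    path-suffix (cons _ _ _ p) (there x∈)  = path-suffix p x∈

    -- Loop erasure: if `x` recurs on the path already built, only the part from that occurrence on
    -- is kept.
    walk⇒path : ∀ {x y} → WalkIn G P x y → ∃ λ us → Path P x y us
    walk⇒path (here p) = [] , stop p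
    walk⇒path {x} (step {w = w} Px e walk) with us , p ← walk⇒path walk with Any.any? (x Fin.≟_) (w ∷ us)
    ... | yes x∈ = path-suffix p x∈
    ... | no x∉  = w ∷ us , cons Px e (All.¬Any⇒All¬ _ x∉) p

    path-unique : ∀ {x y us} → Path P x y us → AllPairs _≢_ (x ∷ us)
    path-unique (stop _)        = [] ∷ []
    path-unique (cons _ _ x≢ p) = x≢ ∷ path-unique p

    path-all : ∀ {x y us} → Path P x y us → All P (x ∷ us)
    path-all (stop p)        = p ∷ []
    path-all (cons p _ _ ps) = p ∷ path-all ps

    path-linked : ∀ {x y z us} → Path P x y us → Edge G y z → Linked (Edge G) (x ∷ us ++ z ∷ [])
    path-linked (stop _)        e = e ∷ [-]
    path-linked (cons _ e′ _ p) e = e′ ∷ path-linked p e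

    path-length : ∀ {x y us} → Path P x y us → x ≢ y → 1 ≤ length us
    path-length (stop _)       x≢x = contradiction refl x≢x
    path-length (cons _ _ _ _) _   = s≤s z≤n

  -- The loop-erased walk avoids `p` and has at least one edge because `x ≢ y`; `p` closes it to a
  -- cycle of length at least 3.
  neighbours-joined⇒cycle : ∀ {p x y} → Edge G p x → Edge G y p → x ≢ y → WalkIn G (_≢ p) x y → HasCycle G
  neighbours-joined⇒cycle {p} {x} px yp x≢y walk with us , path ← walk⇒path walk =
    p , x ∷ us , s≤s (path-length path x≢y) ,
    All.map (_∘ sym) (path-all path) ∷ path-unique path , px ∷ path-linked path yp

module Exploration {n k : ℕ} {G : Graph n} (D : TreeDecompositionOfWidth≤ G k) where
  open TreeDecompositionOfWidth≤ D

  -- The visited part `S` of the tree, already turned into a bag sequence. `contained` transfers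
  -- freshness from tree bags to the bags of the sequence; `connected` supplies the walk that would
  -- close a cycle if a new vertex were not fresh.
  record Explored (S : List (Fin (suc m))) : Set where
    field
      size      : ℕ
      bags      : Fin size → List (Fin n)
      sequence  : BagSequence (suc k) size bags
      contains  : ∀ {i} → i ∈ S → ∃ λ j → ∀ {v} → v ∈ₛ bag i → v ∈ bags j
      contained : ∀ j {v} → v ∈ bags j → ∃ λ i → i ∈ S × v ∈ₛ bag i
      connected : ConnectedOn T (_∈ S)

  length-bag : ∀ i → length (elements (bag i)) ≤ suc k
  length-bag i = subst (_≤ suc k) (sym (length-elements (bag i))) (bagSize i)

  explore-root : Explored (zero ∷ [])
  explore-root = record
    { size      = 1
    ; bags      = (elements (bag zero) ++ []) ◂ λ ()
    ; sequence  = grow* root (elements (bag zero)) (elements-unique (bag zero))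
                    (All.tabulate λ _ ()) (All.tabulate λ _ ())
                    (subst (_≤ suc k) (sym (+-identityʳ _)) (length-bag zero))
    ; contains  = λ { (here refl) → zero , ∈-++⁺ˡ ∘ ∈-elements⁺ }
    ; contained = λ { zero v∈ → zero , here refl ,
                        ∈-elements⁻ (bag zero) (subst (_ ∈_) (++-identityʳ _) v∈) }
    ; connected = λ { _ _ (here refl) (here refl) → here (here refl) }
    }

  module _ {S} (E : Explored S) {p i} (p∈S : p ∈ S) (i∉S : i ∉ S) (pi : Edge T p i) where
    open Explored E

    -- Otherwise a walk from i to j in the bags of v, then within S back to p, closes a cycle.
    bag-fresh : ∀ {v} → v ∈ₛ bag i → v ∉ₛ bag p → ∀ {j} → j ∈ S → v ∉ₛ bag j
    bag-fresh {v} v∈i v∉p {j} j∈S v∈j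
      with y , yp , walk ← walk-before (λ { refl → v∉p v∈j }) (connected j p j∈S p∈S) =
      proj₂ isTree (neighbours-joined⇒cycle pi yp
        (λ { refl → i∉S (proj₁ (walk-end walk)) })
        (walk-++ (walk-map (λ { v∈ refl → v∉p v∈ }) (subtree v i j v∈i v∈j)) (walk-map proj₂ walk)))

    old new : List (Fin n)
    old = filter (_∈? bag p) (elements (bag i))
    new = filter (λ v → ¬? (v ∈? bag p)) (elements (bag i))

    old⊆ : ∀ {v} → v ∈ old → v ∈ₛ bag p
    old⊆ = proj₂ ∘ ∈-filter⁻ (_∈? bag p) {xs = elements (bag i)}

    new⊆ : ∀ {v} → v ∈ new → v ∈ₛ bag i × v ∉ₛ bag p
    new⊆ v∈ with v∈′ , v∉p ← ∈-filter⁻ (λ v → ¬? (v ∈? bag p)) {xs = elements (bag i)} v∈ =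
      ∈-elements⁻ (bag i) v∈′ , v∉p

    new++old⁺ : ∀ {v} → v ∈ₛ bag i → v ∈ new ++ old
    new++old⁺ {v} v∈ with v ∈? bag p
    ... | yes v∈p = ∈-++⁺ʳ new (∈-filter⁺ (_∈? bag p) (∈-elements⁺ v∈) v∈p)
    ... | no  v∉p = ∈-++⁺ˡ (∈-filter⁺ (λ v → ¬? (v ∈? bag p)) (∈-elements⁺ v∈) v∉p)

    new++old⁻ : ∀ {v} → v ∈ new ++ old → v ∈ₛ bag i
    new++old⁻ v∈ with ∈-++⁻ new v∈
    ... | inj₁ q = proj₁ (new⊆ q)
    ... | inj₂ q = ∈-elements⁻ (bag i) (proj₁ (∈-filter⁻ (_∈? bag p) {xs = elements (bag i)} q))

    old-index : Fin size
    old-index = proj₁ (contains p∈S)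

    -- The part `old`, shared with `bag p`, is branched off the bag that holds `bag p`; the vertices
    -- of `new` are then grown one at a time.
    explore-next : Explored (i ∷ S)
    explore-next = record
      { size      = suc size
      ; bags      = (new ++ old) ◂ bags
      ; sequence  = grow* (branch sequence old-index old (proj₂ (contains p∈S) ∘ old⊆)) new
          (AllPairs.filter⁺ (λ v → ¬? (v ∈? bag p)) (elements-unique (bag i)))
          (All.tabulate λ v∈new v∈old → proj₂ (new⊆ v∈new) (old⊆ v∈old))
          (All.tabulate λ v∈new j v∈j → let v∈i , v∉p = new⊆ v∈new ; _ , l∈S , v∈l = contained j v∈j in
            bag-fresh v∈i v∉p l∈S v∈l)
          (subst (_≤ suc k) (sym (trans (+-comm (length new) (length old))
            (length-filter-complement (_∈? bag p) (elements (bag i))))) (length-bag i))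
      ; contains  = λ { (here refl)  → zero , new++old⁺
                      ; (there l∈S) → let j , sub = contains l∈S in suc j , sub }
      ; contained = λ { zero v∈    → i , here refl , new++old⁻ v∈
                      ; (suc j) v∈ → let l , l∈S , v∈l = contained j v∈ in l , there l∈S , v∈l }
      ; connected = λ { _ _ (here refl) (here refl) → here (here refl)
                      ; _ v (here refl) (there v∈)  → step (here refl) ip (inside-S p v p∈S v∈)
                      ; u _ (there u∈)  (here refl) →
                          walk-++ (inside-S u p u∈ p∈S) (step (there p∈S) pi (here (here refl)))
                      ; u v (there u∈)  (there v∈)  → inside-S u v u∈ v∈ }
      }
      where
      ip : Edge T i p
      ip = trans (adj-sym T i p) pi
      inside-S : ∀ u v → u ∈ S → v ∈ S → WalkIn T (_∈ (i ∷ S)) u v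
      inside-S u v u∈ v∈ = walk-map there (connected u v u∈ v∈)

  explore-walk : ∀ {S P u z} → Explored S → u ∈ S → WalkIn T P u z →
    ∃ λ S′ → Explored S′ × (∀ {x} → x ∈ S → x ∈ S′) × z ∈ S′
  explore-walk E u∈ (here _) = _ , E , id , u∈
  explore-walk {S} E u∈ (step {w = w} _ e walk) with Any.any? (w Fin.≟_) S
  ... | yes w∈ = explore-walk E w∈ walk
  ... | no  w∉ with S′ , E′ , S⊆ , z∈ ← explore-walk (explore-next E u∈ w∉ e) (here refl) walk =
    S′ , E′ , S⊆ ∘ there , z∈

  explore-list : ∀ zs {S} → Explored S → zero ∈ S →
    ∃ λ S′ → Explored S′ × (∀ {x} → x ∈ S → x ∈ S′) × All (_∈ S′) zs
  explore-list []       E _  = _ , E , id , []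
  explore-list (z ∷ zs) E 0∈
    with _ , E₁ , S⊆₁ , z∈ ← explore-walk E 0∈ (proj₁ isTree zero z)
    with S₂ , E₂ , S⊆₂ , zs∈ ← explore-list zs E₁ (S⊆₁ 0∈) =
    S₂ , E₂ , S⊆₂ ∘ S⊆₁ , S⊆₂ z∈ ∷ zs∈

  eliminationForest : ∃ λ (colour : Fin n → Fin (suc k)) → ∃ λ F →
    Elimination.Valid G colour F × (∀ v → v ∈ verts F)
  eliminationForest
    with S , E , _ , all∈ ← explore-list (allFin (suc m)) explore-root (here refl)
    with colour , injective ← colouring (Explored.sequence E) =
    let open Explored E
        bag-of = λ i → contains (All.lookup all∈ (∈-allFin i)) in
    colour , eliminate G colour {F = λ _ → leaf} sequence record
      { injective = injective
      ; valid     = λ _ → Elimination.leaf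
      ; shadowed  = λ _ _ → Elimination.leaf
      ; closed    = λ _ ()
      ; fresh     = λ _ _ ()
      ; disjoint  = λ ()
      ; edge      = λ {u} {v} _ _ e → let i , u∈ , v∈ = edges u v e ; j , sub = bag-of i in j , sub u∈ , sub v∈
      ; cover     = λ v → let i , v∈ = covers v ; j , sub = bag-of i in inj₁ (j , sub v∈)
      }

-- Isomorphisms from lists of matched vertices

module _ {n : ℕ} (G : Graph n) where
  open Matching G

  Dom-≡ : ∀ {X W : Subset n} {a b : Dom X W} → proj₁ a ≡ proj₁ b → a ≡ b
  Dom-≡ {a = _ , p} {b = _ , q} refl = cong (_ ,_) ([]=-irrelevant p q)

  -- Two pairs with a common coordinate cannot be `Matched`, hence coincide; so `ms` is the graph of
  -- a bijection.
  matching⇒Iso : ∀ X W Z (ms : List (Fin n × Fin n)) → AllPairs Matched ms →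
    (∀ {a} → a ∈ₛ X ∪ W → ∃ λ b → (a , b) ∈ ms) → (∀ {b} → b ∈ₛ X ∪ Z → ∃ λ a → (a , b) ∈ ms) →
    (∀ {a b} → (a , b) ∈ ms → a ∈ₛ X ∪ W × b ∈ₛ X ∪ Z) → (∀ {x} → x ∈ₛ X → (x , x) ∈ ms) →
    Iso G (X , W) (X , Z)
  matching⇒Iso X W Z ms matched left right sound fixed =
    refl , mk⤖ {to = to} (to-injective , to-surjective) ,
    (λ v p v∈X → functional (proj₂ (left p)) (fixed v∈X)) ,
    λ (a , a∈) (b , b∈) → preserves (proj₂ (left a∈)) (proj₂ (left b∈))
    where
    functional : ∀ {a b c} → (a , b) ∈ ms → (a , c) ∈ ms → b ≡ c
    functional p q with AllPairs-lookup Matched-sym matched p q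
    ... | inj₁ refl          = refl
    ... | inj₂ (_ , a≢a , _) = contradiction refl a≢a

    cofunctional : ∀ {a b c} → (a , c) ∈ ms → (b , c) ∈ ms → a ≡ b
    cofunctional p q with AllPairs-lookup Matched-sym matched p q
    ... | inj₁ refl          = refl
    ... | inj₂ (_ , _ , c≢c) = contradiction refl c≢c

    preserves : ∀ {a b a′ b′} → (a , a′) ∈ ms → (b , b′) ∈ ms → adj G a b ≡ adj G a′ b′
    preserves p q with AllPairs-lookup Matched-sym matched p q
    ... | inj₁ refl     = trans (adj-irrefl G _) (sym (adj-irrefl G _))
    ... | inj₂ (eq , _) = eq

    to : Dom X W → Dom X Z
    to (a , a∈) = proj₁ (left a∈) , proj₂ (sound (proj₂ (left a∈)))

    to-injective : ∀ {a b} → to a ≡ to b → a ≡ b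
    to-injective {_ , a∈} {_ , b∈} eq = Dom-≡
      (cofunctional (proj₂ (left a∈)) (subst (λ c → (_ , c) ∈ ms) (sym (cong proj₁ eq)) (proj₂ (left b∈))))

    to-surjective : ∀ b → ∃ λ a → ∀ {c} → c ≡ a → to c ≡ b
    to-surjective (b , b∈) with a , ab ← right b∈ =
      (a , proj₁ (sound ab)) , λ { refl → Dom-≡ (functional (proj₂ (left (proj₁ (sound ab)))) ab) }

AllPairs-resp-↭ : {A : Set} {R : A → A → Set} → Symmetric R → ∀ {xs ys} → xs ↭ ys →
  AllPairs R xs → AllPairs R ys
AllPairs-resp-↭ {A} {R} R-sym p =
  Permutation.AllPairs-resp-↭ (setoid A) R-sym ((λ { refl r → r }) , (λ { refl r → r })) (↭⇒↭ₛ p)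

AllPairs-with : {A : Set} {P : A → Set} {R : A → A → Set} → ∀ {xs} → All P xs → AllPairs R xs →
  AllPairs (λ x y → P x × P y × R x y) xs
AllPairs-with []       []       = []
AllPairs-with (p ∷ ps) (r ∷ rs) = All.zipWith (λ (q , r) → p , q , r) (ps , r) ∷ AllPairs-with ps rs

∈-map-proj₁⁻ : {A B : Set} (ms : List (A × B)) → ∀ {a} → a ∈ map proj₁ ms → ∃ λ b → (a , b) ∈ ms
∈-map-proj₁⁻ ms a∈ with (_ , b) , m∈ , refl ← ∈-map⁻ proj₁ a∈ = b , m∈

∈-map-proj₂⁻ : {A B : Set} (ms : List (A × B)) → ∀ {b} → b ∈ map proj₂ ms → ∃ λ a → (a , b) ∈ ms
∈-map-proj₂⁻ ms b∈ with (a , _) , m∈ , refl ← ∈-map⁻ proj₂ b∈ = a , m∈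

length-concatMap : {A B : Set} (f : A → List B) {b : ℕ} → ∀ xs → All (λ x → length (f x) ≤ b) xs →
  length (concatMap f xs) ≤ length xs * b
length-concatMap f []       []        = z≤n
length-concatMap f (x ∷ xs) (le ∷ les) =
  ≤-trans (≤-reflexive (length-++ (f x))) (+-mono-≤ le (length-concatMap f xs les))

∈-take-1 : {A : Set} {x : A} {xs : List A} → x ∈ xs → ∃ λ y → y ∈ take 1 xs
∈-take-1 {xs = y ∷ _} _ = y , here refl

-- Representatives for a fixed separator

-- An upper bound for the number of labels: colours times two bit words of length at most k + 1,
-- each counted by `length-words` with base 3.
vertexTypes : ℕ → ℕ
vertexTypes k = suc k * (3 ^ suc k * 3 ^ suc k)

module Separator {n k : ℕ} (G : Graph n) (colour : Fin n → Fin (suc k)) (F : Forest (Fin n))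
  (valid : Elimination.Valid G colour F) (all∈ : ∀ v → v ∈ verts F) (q : ℕ) (X : Subset n) where
  open Matching G
  open Elimination G colour hiding (leaf; node)

  Closed : Subset n → Set
  Closed W = (∀ v → v ∈ₛ X → v ∈ₛ W → ⊥) ×
             (∀ v → v ∈ₛ W → ∀ u → Edge G v u → u ∈ₛ W ⊎ u ∈ₛ X)

  closed? : Decidable Closed
  closed? W =
    Fin.all? (λ v → (v ∈? X) →-dec ¬? (v ∈? W)) ×-dec
    Fin.all? (λ v → (v ∈? W) →-dec Fin.all? λ u →
      (adj G v u Bool.≟ true) →-dec ((u ∈? W) ⊎-dec (u ∈? X)))

  closedSets : List (Subset n)
  closedSets = filter closed? (smallSubsets n n)

  ∈-closedSets : ∀ {W} → Closed W → W ∈ closedSets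
  ∈-closedSets {W} cl = ∈-filter⁺ closed? (∈-smallSubsets W (∣p∣≤n W)) cl

  -- Vertices with the same profile form the atoms of the algebra of closed sets,
  -- which are the connected components of G − X (and X itself).
  profile : Fin n → List Bool
  profile u = map (λ W → Vec.lookup W u) closedSets

  profile-∈ : ∀ {W u v} → Closed W → profile u ≡ profile v → u ∈ₛ W → v ∈ₛ W
  profile-∈ {W} {u} {v} cl eq u∈ =
    lookup⇒[]= v W (trans (sym (map-≡-lookup eq (∈-closedSets cl))) ([]=⇒lookup u∈))

  lookup-cong : ∀ {W : Subset n} {u v} → (u ∈ₛ W → v ∈ₛ W) → (v ∈ₛ W → u ∈ₛ W) → Vec.lookup W u ≡ Vec.lookup W v
  lookup-cong {W} {u} {v} f g with Vec.lookup W u in p | Vec.lookup W v in r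
  ... | true  | true  = refl
  ... | false | false = refl
  ... | true  | false = trans (sym ([]=⇒lookup (f (lookup⇒[]= u W p)))) r
  ... | false | true  = trans (sym p) ([]=⇒lookup (g (lookup⇒[]= v W r)))

  -- A closed set containing one end of an edge that avoids `X` contains the other end as well.
  edge-profile : ∀ {u v} → u ∉ₛ X → v ∉ₛ X → Edge G u v → profile u ≡ profile v
  edge-profile {u} {v} u∉ v∉ e = map-cong-local (All.tabulate λ {W} W∈ →
    let _ , cl = proj₂ (∈-filter⁻ closed? {xs = smallSubsets n n} W∈) in
    lookup-cong (λ u∈ → [ id , (λ v∈ → contradiction v∈ v∉) ]′ (cl u u∈ v e))
                (λ v∈ → [ id , (λ u∈ → contradiction u∈ u∉) ]′ (cl v v∈ u (trans (adj-sym G v u) e))))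

  profile-Apart : ∀ {u v} → u ∉ₛ X → v ∉ₛ X → profile u ≢ profile v → Apart u v
  profile-Apart u∉ v∉ ne = (λ { refl → ne refl }) , nonadjacent G (ne ∘ edge-profile u∉ v∉)

  _≟ₚ_ : DecidableEquality (List Bool)
  _≟ₚ_ = ≡-dec Bool._≟_

  -- Components and their codes

  open Classes _≟ₚ_ profile

  component : Fin n → Forest (Fin n)
  component r = restrict (λ a → profile a ≟ₚ profile r) F

  verts-component : ∀ r → verts (component r) ≡ class r (verts F)
  verts-component r = verts-restrict (λ a → profile a ≟ₚ profile r) F

  component-profile : ∀ r → All (λ a → profile a ≡ profile r) (verts (component r))
  component-profile r = subst (All _) (sym (verts-component r))
    (All.all-filter (λ a → profile a ≟ₚ profile r) (verts F))

  mark : Fin n → List Bool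
  mark v = map (adj G v) (elements X)

  open Annotation mark

  -- The default row: a colour without an ancestor inside the component yields the bit `false`.
  noAncestors : Env
  noAncestors _ _ = false

  size : Fin n → ℕ
  size r = length (class r (verts F))

  description : Fin n → Forest (Label (suc k))
  description r = annotate noAncestors (component r)

  code : Fin n → List (Maybe (Label (suc k)))
  code r = encode (description r)

  length-code : ∀ r → length (code r) ≡ suc (size r + size r)
  length-code r = trans (length-encode (description r)) (cong (λ l → suc (l + l))
    (trans (verts-annotate noAncestors (component r)) (cong length (verts-component r))))

  -- Large components are recorded individually, small ones only up to isomorphism over X.
  Key : Set
  Key = Fin n ⊎ List (Maybe (Label (suc k)))

  _≟ₖ_ : DecidableEquality Key
  _≟ₖ_ = Sum.≡-dec Fin._≟_ (≡-dec (Maybe.≡-dec (Product.≡-dec Fin._≟_ (Product.≡-dec _≟ₚ_ _≟ₚ_))))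

  key : Fin n → Key
  key r with size r ≤? q
  ... | yes _ = inj₂ (code r)
  ... | no  _ = inj₁ r

  key-inj₁ : ∀ {r s} → key r ≡ inj₁ s → r ≡ s
  key-inj₁ {r} eq with size r ≤? q
  key-inj₁ refl | no _ = refl

  -- For small components codes are injective; for large ones equal keys mean the same
  -- representative.
  key⇒description : ∀ {r s} → key r ≡ key s → description r ≡ description s
  key⇒description {r} {s} eq with size r ≤? q | size s ≤? q
  key⇒description eq   | yes _ | yes _ = encode-injective (Sum.inj₂-injective eq)
  key⇒description refl | no _  | no _  = refl

  -- Signatures and their number

  open Counting _≟ₖ_ key

  representatives : List (Fin n)
  representatives = reps (verts F)

  representatives-unique : AllPairs _≢_ representatives
  representatives-unique = AllPairs.map (λ ne → λ { refl → ne refl }) (reps-distinct (verts F))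

  chosen : Subset n → List (Fin n)
  chosen W = filter (_∈? W) representatives

  chosen-unique : ∀ W → AllPairs _≢_ (chosen W)
  chosen-unique W = AllPairs.filter⁺ (_∈? W) representatives-unique

  large : List (Fin n)
  large = filter (λ r → ¬? (size r ≤? q)) representatives

  bits : List (List Bool)
  bits = words (true ∷ false ∷ []) (suc k)

  labels : List (Label (suc k))
  labels = cartesianProduct (allFin (suc k)) (cartesianProduct bits bits)

  tokens : List (Maybe (Label (suc k)))
  tokens = nothing ∷ map just labels

  codes : List (List (Maybe (Label (suc k))))
  codes = words tokens (suc (q + q))

  keys : List Key
  keys = map inj₁ large ++ map inj₂ codes

  signature : Subset n → List ℕ
  signature W = map (λ t → count t (chosen W)) keys

  -- A multiplicity runs from 0 to its bound, so a large component contributes a factor 2 and a code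
  -- a factor n + 1.
  bound : Key → ℕ
  bound (inj₁ _) = 1
  bound (inj₂ _) = n

  count≤bound : ∀ W t → count t (chosen W) ≤ bound t
  count≤bound W (inj₁ r) = length-filter≤1 (λ a → key a ≟ₖ inj₁ r)
    (λ p p′ → trans (key-inj₁ p) (sym (key-inj₁ p′))) (chosen-unique W)
  count≤bound W (inj₂ c) = ≤-trans (length-filter (λ a → key a ≟ₖ inj₂ c) (chosen W))
    (unique⇒length≤ (chosen-unique W))

  signatures : List (List ℕ)
  signatures = boxes (map bound keys)

  signature-∈ : ∀ W → signature W ∈ signatures
  signature-∈ W = ∈-boxes (count≤bound W) keys

  product-inj₂ : ∀ cs → product (map suc (map bound (map inj₂ cs))) ≡ suc n ^ length cs
  product-inj₂ []       = refl
  product-inj₂ (c ∷ cs) = cong (suc n *_) (product-inj₂ cs)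

  product-keys : ∀ rs cs → product (map suc (map bound (map inj₁ rs ++ map inj₂ cs))) ≡
    2 ^ length rs * suc n ^ length cs
  product-keys []       cs = trans (product-inj₂ cs) (sym (*-identityˡ _))
  product-keys (r ∷ rs) cs = trans (cong (2 *_) (product-keys rs cs))
    (sym (*-assoc 2 (2 ^ length rs) (suc n ^ length cs)))

  length-signatures : length signatures ≡ 2 ^ length large * suc n ^ length codes
  length-signatures = trans (length-boxes (map bound keys)) (product-keys large codes)

  length-large : length large * suc q ≤ n
  length-large = ≤-trans
    (count-large-classes (suc q) large (verts F)
      (AllPairs.filter⁺ (λ r → ¬? (size r ≤? q)) (reps-distinct (verts F)))
      (All.map ≰⇒> (All.all-filter (λ r → ¬? (size r ≤? q)) representatives)))
    (unique⇒length≤ (Valid⇒unique valid))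

  length-tokens : length tokens ≤ suc (vertexTypes k)
  length-tokens = s≤s (begin
    length (map just labels)
      ≡⟨ length-map just labels ⟩
    length labels
      ≡⟨ length-cartesianProductWith _,_ (allFin (suc k)) (cartesianProduct bits bits) ⟩
    length (allFin (suc k)) * length (cartesianProduct bits bits)
      ≡⟨ cong₂ _*_ (length-tabulate {n = suc k} id) (length-cartesianProductWith _,_ bits bits) ⟩
    suc k * (length bits * length bits)
      ≤⟨ *-monoʳ-≤ (suc k) (*-mono-≤ length-bits length-bits) ⟩
    vertexTypes k ∎)
    where
    open ≤-Reasoning
    length-bits : length bits ≤ 3 ^ suc k
    length-bits = length-words (true ∷ false ∷ []) (suc k)

  length-codes : length codes ≤ (2 + vertexTypes k) ^ suc (q + q)
  length-codes = ≤-trans (length-words tokens (suc (q + q)))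
    (^-monoˡ-≤ (suc (q + q)) (s≤s length-tokens))

  module _ (X≤ : ∣ X ∣ ≤ suc k) where

    ∈-bits : ∀ w → length w ≤ suc k → w ∈ bits
    ∈-bits w = ∈-words (All.tabulate λ {b} _ → bool b)
      where
      bool : ∀ b → b ∈ true ∷ false ∷ []
      bool true  = here refl
      bool false = there (here refl)

    label-∈ : ∀ e v → label e v ∈ labels
    label-∈ e v = ∈-cartesianProduct⁺ (∈-allFin (colour v)) (∈-cartesianProduct⁺
      (∈-bits _ (≤-reflexive (trans (length-map _ (allFin (suc k))) (length-tabulate {n = suc k} id))))
      (∈-bits _ (≤-trans (≤-reflexive (trans (length-map _ (elements X)) (length-elements X))) X≤)))

    encode-tokens : ∀ e H → All (_∈ tokens) (encode (annotate e H))
    encode-tokens e leaf           = here refl ∷ []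
    encode-tokens e (node v cs ss) = there (∈-map⁺ just (label-∈ e v)) ∷
      All.++⁺ (encode-tokens (push e v) cs) (encode-tokens e ss)

    key-∈ : ∀ {r} → r ∈ representatives → key r ∈ keys
    key-∈ {r} r∈ with size r ≤? q
    ... | no  ¬p = ∈-++⁺ˡ (∈-map⁺ inj₁ (∈-filter⁺ (λ r → ¬? (size r ≤? q)) r∈ ¬p))
    ... | yes le = ∈-++⁺ʳ (map inj₁ large) (∈-map⁺ inj₂
      (∈-words (encode-tokens noAncestors (component r))
        (≤-trans (≤-reflexive (length-code r)) (s≤s (+-mono-≤ le le)))))

    chosen-key-∈ : ∀ W {r} → r ∈ chosen W → key r ∈ keys
    chosen-key-∈ W r∈ = key-∈ (proj₁ (∈-filter⁻ (_∈? W) {xs = representatives} r∈))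

    -- The isomorphism given by a pairing of the chosen components

    module _ {W Z : Subset n} (cW : Closed W) (cZ : Closed Z) (ps : List (Fin n × Fin n))
             (same : All (λ p → key (proj₁ p) ≡ key (proj₂ p)) ps)
             (fsts : map proj₁ ps ↭ chosen W) (snds : map proj₂ ps ↭ chosen Z) where

      zipped : Fin n × Fin n → List (Fin n × Fin n)
      zipped (r , s) = zipF (component r) (component s)

      matches : List (Fin n × Fin n)
      matches = concatMap zipped ps

      fst-∈ : ∀ {p} → p ∈ ps → proj₁ p ∈ₛ W
      fst-∈ p∈ = proj₂ (∈-filter⁻ (_∈? W) {xs = representatives} (∈-resp-↭ fsts (∈-map⁺ proj₁ p∈)))

      snd-∈ : ∀ {p} → p ∈ ps → proj₂ p ∈ₛ Z
      snd-∈ p∈ = proj₂ (∈-filter⁻ (_∈? Z) {xs = representatives} (∈-resp-↭ snds (∈-map⁺ proj₂ p∈)))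

      zipped-profile : ∀ p → All (λ m → profile (proj₁ m) ≡ profile (proj₁ p) ×
                                        profile (proj₂ m) ≡ profile (proj₂ p)) (zipped p)
      zipped-profile (r , s) = All-zipF (component r) (component s) (component-profile r) (component-profile s)

      ∈-matches : ∀ {m} → m ∈ matches → ∃ λ p → p ∈ ps × m ∈ zipped p
      ∈-matches = find ∘ ∈-concatMap⁻ zipped

      matches-sound : ∀ {a b} → (a , b) ∈ matches → a ∈ₛ W × b ∈ₛ Z
      matches-sound m∈ = let p , p∈ , m∈p = ∈-matches m∈ ; e₁ , e₂ = All.lookup (zipped-profile p) m∈p in
        profile-∈ cW (sym e₁) (fst-∈ p∈) , profile-∈ cZ (sym e₂) (snd-∈ p∈)

      ∉X : ∀ {V v} → Closed V → v ∈ₛ V → v ∉ₛ X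
      ∉X (disj , _) v∈ v∈X = disj _ v∈X v∈

      distinct-fst : AllPairs (λ p p′ → profile (proj₁ p) ≢ profile (proj₁ p′)) ps
      distinct-fst = AllPairs.map⁻ (AllPairs-resp-↭ (λ ne → ne ∘ sym) (↭-sym fsts)
        (AllPairs.filter⁺ (_∈? W) (reps-distinct (verts F))))

      distinct-snd : AllPairs (λ p p′ → profile (proj₂ p) ≢ profile (proj₂ p′)) ps
      distinct-snd = AllPairs.map⁻ (AllPairs-resp-↭ (λ ne → ne ∘ sym) (↭-sym snds)
        (AllPairs.filter⁺ (_∈? Z) (reps-distinct (verts F))))

      -- Inside a pair of components the equal descriptions decide. Vertices of different components
      -- have different profiles and lie outside `X`, so they are apart on both sides.
      matches-matched : AllPairs Matched matches
      matches-matched = AllPairs.concat⁺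
        (All.map⁺ (All.map (λ {p} eq → zip-matched (component (proj₁ p)) (component (proj₂ p))
          (key⇒description eq) (Valid-restrict _ valid) (Valid-restrict _ valid)) same))
        (AllPairs.map⁺ (AllPairs.map cross (AllPairs-with
          (All.tabulate λ p∈ → fst-∈ p∈ , snd-∈ p∈) (AllPairs.zip (distinct-fst , distinct-snd)))))
        where
        cross : ∀ {p p′} → (proj₁ p ∈ₛ W × proj₂ p ∈ₛ Z) × (proj₁ p′ ∈ₛ W × proj₂ p′ ∈ₛ Z) ×
          (profile (proj₁ p) ≢ profile (proj₁ p′) × profile (proj₂ p) ≢ profile (proj₂ p′)) →
          All (λ m → All (Matched m) (zipped p′)) (zipped p)
        cross {p} {p′} ((p∈W , p∈Z) , (p′∈W , p′∈Z) , ne₁ , ne₂) =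
          All.map (λ (e₁ , e₂) → All.map (λ (e₁′ , e₂′) → Apart⇒Matched
            ( profile-Apart (∉X cW (profile-∈ cW (sym e₁) p∈W)) (∉X cW (profile-∈ cW (sym e₁′) p′∈W))
                (λ eq → ne₁ (trans (sym e₁) (trans eq e₁′)))
            , profile-Apart (∉X cZ (profile-∈ cZ (sym e₂) p∈Z)) (∉X cZ (profile-∈ cZ (sym e₂′) p′∈Z))
                (λ eq → ne₂ (trans (sym e₂) (trans eq e₂′)))))
            (zipped-profile p′)) (zipped-profile p)

      matches-mark : All (λ m → mark (proj₁ m) ≡ mark (proj₂ m)) matches
      matches-mark = All.concat⁺ (All.map⁺ (All.map (λ {p} eq →
        zip-mark (component (proj₁ p)) (component (proj₂ p)) (key⇒description eq)) same))

      chosen-∋ : ∀ {V v} → Closed V → v ∈ₛ V → ∃ λ r → r ∈ chosen V × v ∈ verts (component r)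
      chosen-∋ {V} {v} cV v∈ = let r , r∈ , eq = ∈-reps (all∈ v) in
        r , ∈-filter⁺ (_∈? V) r∈ (profile-∈ cV eq v∈) ,
        subst (v ∈_) (sym (verts-component r)) (∈-filter⁺ (λ a → profile a ≟ₚ profile r) (all∈ v) eq)

      left : ∀ {a} → a ∈ₛ W → ∃ λ b → (a , b) ∈ matches
      left {a} a∈ =
        let r , r∈ , a∈r = chosen-∋ cW a∈
            s , rs∈      = ∈-map-proj₁⁻ ps (∈-resp-↭ (↭-sym fsts) r∈)
            zip≡         = zip-fst (component r) (component s) (key⇒description (All.lookup same rs∈))
            b , ab∈      = ∈-map-proj₁⁻ (zipped (r , s)) (subst (a ∈_) (sym zip≡) a∈r)
        in b , ∈-concatMap⁺ zipped (lose rs∈ ab∈)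

      right : ∀ {b} → b ∈ₛ Z → ∃ λ a → (a , b) ∈ matches
      right {b} b∈ =
        let s , s∈ , b∈s = chosen-∋ cZ b∈
            r , rs∈      = ∈-map-proj₂⁻ ps (∈-resp-↭ (↭-sym snds) s∈)
            zip≡         = zip-snd (component r) (component s) (key⇒description (All.lookup same rs∈))
            a , ab∈      = ∈-map-proj₂⁻ (zipped (r , s)) (subst (b ∈_) (sym zip≡) b∈s)
        in a , ∈-concatMap⁺ zipped (lose rs∈ ab∈)

      fixed : List (Fin n × Fin n)
      fixed = map (λ x → x , x) (elements X)

      ∈-fixed : ∀ {a b} → (a , b) ∈ fixed → a ≡ b × a ∈ₛ X
      ∈-fixed m∈ with x , x∈ , refl ← ∈-map⁻ _ m∈ = refl , ∈-elements⁻ X x∈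

      fixed-matched : AllPairs Matched fixed
      fixed-matched = AllPairs.map⁺ (AllPairs.map (λ ne → refl , ne , ne) (elements-unique X))

      -- `mark` is part of the label, so matched vertices have the same neighbours in `X`.
      fixed-cross : All (λ m → All (Matched m) matches) fixed
      fixed-cross = All.map⁺ (All.tabulate λ {x} x∈ → All.tabulate λ {m} m∈ →
        let a∈ , b∈ = matches-sound m∈ ; x∈X = ∈-elements⁻ X x∈ in
        trans (adj-sym G x (proj₁ m))
          (trans (map-≡-lookup (All.lookup matches-mark m∈) x∈) (adj-sym G (proj₂ m) x)) ,
        (λ { refl → ∉X cW a∈ x∈X }) , (λ { refl → ∉X cZ b∈ x∈X }))

      pairing⇒Iso : Iso G (X , W) (X , Z)
      pairing⇒Iso = matching⇒Iso G X W Z (fixed ++ matches)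
        (AllPairs.++⁺ fixed-matched matches-matched fixed-cross)
        (λ a∈ → [ (λ a∈X → _ , fix a∈X) , (λ a∈W → let b , m∈ = left a∈W in b , ∈-++⁺ʳ fixed m∈) ]′ (x∈p∪q⁻ X W a∈))
        (λ b∈ → [ (λ b∈X → _ , fix b∈X) , (λ b∈Z → let a , m∈ = right b∈Z in a , ∈-++⁺ʳ fixed m∈) ]′ (x∈p∪q⁻ X Z b∈))
        sound fix
        where
        fix : ∀ {x} → x ∈ₛ X → (x , x) ∈ fixed ++ matches
        fix x∈ = ∈-++⁺ˡ (∈-map⁺ _ (∈-elements⁺ x∈))
        sound : ∀ {a b} → (a , b) ∈ fixed ++ matches → a ∈ₛ X ∪ W × b ∈ₛ X ∪ Z
        sound m∈ =
          [ (λ m∈′ → let eq , x∈ = ∈-fixed m∈′ in x∈p∪q⁺ (inj₁ x∈) , x∈p∪q⁺ (inj₁ (subst (_∈ₛ X) eq x∈)))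
          , (λ m∈′ → let a∈ , b∈ = matches-sound m∈′ in x∈p∪q⁺ (inj₂ a∈) , x∈p∪q⁺ (inj₂ b∈))
          ]′ (∈-++⁻ fixed m∈)

    signature⇒Iso : ∀ {W Z} → Closed W → Closed Z → signature W ≡ signature Z → Iso G (X , W) (X , Z)
    signature⇒Iso {W} {Z} cW cZ eq =
      let ps , same , fsts , snds = pairing (chosen W) (chosen Z) 
             (count-ext keys (chosen W) (chosen Z) (chosen-key-∈ W) (chosen-key-∈ Z) eq)
      in pairing⇒Iso cW cZ ps same (↭-reflexive fsts) snds

  -- One closed set for each signature

  realises? : ∀ σ → Decidable (λ W → Closed W × signature W ≡ σ)
  realises? σ W = closed? W ×-dec ≡-dec _≟_ (signature W) σ

  realisers : List ℕ → List (Subset n)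
  realisers σ = filter (realises? σ) (smallSubsets n n)

  -- `take 1` keeps the first closed set with a given signature; signatures that no closed set has
  -- contribute nothing.
  selection : List (Subset n)
  selection = concatMap (take 1 ∘ realisers) signatures

  selection-closed : All Closed selection
  selection-closed = All.concat⁺ (All.map⁺ (All.universal
    (λ σ → All.take⁺ 1 (All.map proj₁ (All.all-filter (realises? σ) (smallSubsets n n)))) signatures))

  length-selection : length selection ≤ 2 ^ length large * suc n ^ length codes
  length-selection = begin
    length selection
      ≤⟨ length-concatMap (take 1 ∘ realisers) signatures (All.universal (λ σ →
           ≤-trans (≤-reflexive (length-take 1 (realisers σ))) (m⊓n≤m 1 _)) signatures) ⟩
    length signatures * 1  ≡⟨ *-identityʳ (length signatures) ⟩
    length signatures      ≡⟨ length-signatures ⟩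
    2 ^ length large * suc n ^ length codes ∎
    where open ≤-Reasoning

  -- `W` realises its own signature, so the search for that signature finds some `Z`.
  selection-complete : ∣ X ∣ ≤ suc k → ∀ {W} → Closed W → ∃ λ Z → Z ∈ selection × Iso G (X , W) (X , Z)
  selection-complete X≤ {W} cW =
    let Z , Z∈  = ∈-take-1 (∈-filter⁺ (realises? (signature W)) (∈-smallSubsets W (∣p∣≤n W)) (cW , refl))
        cZ , eq = All.lookup (All.take⁺ 1 (All.all-filter (realises? (signature W)) (smallSubsets n n))) Z∈
    in Z , ∈-concatMap⁺ (take 1 ∘ realisers) (lose (signature-∈ W) Z∈) , signature⇒Iso X≤ cW cZ (sym eq)

-- Arithmetic

open ≤-Reasoning

suc≤2^ : ∀ m → suc m ≤ 2 ^ m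
suc≤2^ zero    = ≤-refl
suc≤2^ (suc m) = begin
  suc (suc m)             ≡⟨ +-comm 1 (suc m) ⟩
  suc m + 1               ≤⟨ +-mono-≤ (suc≤2^ m) (m^n>0 2 m) ⟩
  2 ^ m + 2 ^ m           ≡⟨ cong (2 ^ m +_) (sym (+-identityʳ (2 ^ m))) ⟩
  2 ^ suc m               ∎

n<2^[1+⌊log₂n⌋] : ∀ n → n < 2 ^ suc ⌊log₂ n ⌋
n<2^[1+⌊log₂n⌋] n = ≰⇒> λ le → <⇒≱ (n<1+n ⌊log₂ n ⌋)
  (subst (_≤ ⌊log₂ n ⌋) (⌊log₂[2^n]⌋≡n (suc ⌊log₂ n ⌋)) (⌊log₂⌋-mono-≤ le))

2^⌊log₂n⌋≤n : ∀ n → 1 ≤ n → 2 ^ ⌊log₂ n ⌋ ≤ n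
2^⌊log₂n⌋≤n = <-rec _ λ where
  1             _   _ → ≤-refl
  n@(suc (suc m)) rec _ → begin
    2 ^ ⌊log₂ n ⌋
      ≤⟨ ^-monoʳ-≤ 2 (m≤n+m∸n ⌊log₂ n ⌋ 1) ⟩
    2 * 2 ^ (⌊log₂ n ⌋ ∸ 1)
      ≡⟨ cong (λ l → 2 * 2 ^ l) (sym (⌊log₂⌊n/2⌋⌋≡⌊log₂n⌋∸1 n)) ⟩
    2 * 2 ^ ⌊log₂ ⌊ n /2⌋ ⌋
      ≤⟨ *-monoʳ-≤ 2 (rec (⌊n/2⌋<n (suc m)) (s≤s z≤n)) ⟩
    2 * ⌊ n /2⌋
      ≡⟨ cong (⌊ n /2⌋ +_) (+-identityʳ ⌊ n /2⌋) ⟩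
    ⌊ n /2⌋ + ⌊ n /2⌋
      ≤⟨ +-monoʳ-≤ ⌊ n /2⌋ (⌊n/2⌋≤⌈n/2⌉ n) ⟩
    ⌊ n /2⌋ + ⌈ n /2⌉
      ≡⟨ ⌊n/2⌋+⌈n/2⌉≡n n ⟩
    n ∎

m*n≤o⇒m≤o/n : ∀ m n o .{{_ : NonZero n}} → m * n ≤ o → m ≤ o / n
m*n≤o⇒m≤o/n m n o le = subst (_≤ o / n) (m*n/n≡m m n) (/-monoˡ-≤ n le)

1+m≤[1+m/n]*n : ∀ m n .{{_ : NonZero n}} → suc m ≤ suc (m / n) * n
1+m≤[1+m/n]*n m n = begin
  suc m                 ≡⟨ cong suc (m≡m%n+[m/n]*n m n) ⟩
  suc (m % n) + m / n * n ≤⟨ +-monoˡ-≤ (m / n * n) (m%n<n m n) ⟩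
  suc (m / n) * n       ∎

-- The first summand pays for the choice of `X` and for the small components, the second for the
-- large ones.
constant : ℕ → ℕ → ℕ
constant k a = 4 * a * (4 * a) * (k + 1 + 2 ^ a) + 4 * a

module Exponent {k a n ℓ q : ℕ} (1≤a : 1 ≤ a) (2^ℓ≤n : 2 ^ ℓ ≤ n) (n<2^[1+ℓ] : n < 2 ^ suc ℓ)
  (lower : q * (4 * a) ≤ ℓ) (upper : suc ℓ ≤ suc q * (4 * a)) where

  private
    d = 4 * a
    L = suc ℓ
    M = a ^ suc (q + q)

  a≤2^a : a ≤ 2 ^ a
  a≤2^a = ≤-trans (n≤1+n a) (suc≤2^ a)

  M≤ : k + 1 + M ≤ (k + 1 + 2 ^ a) * 2 ^ (a * (q + q))
  M≤ = begin
    k + 1 + M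
      ≤⟨ +-mono-≤ (m≤m*n (k + 1) (2 ^ (a * (q + q))) {{m^n≢0 2 (a * (q + q))}}) (^-monoˡ-≤ (suc (q + q)) a≤2^a) ⟩
    (k + 1) * 2 ^ (a * (q + q)) + 2 ^ a * (2 ^ a) ^ (q + q)
      ≡⟨ cong (λ x → (k + 1) * 2 ^ (a * (q + q)) + 2 ^ a * x) (^-*-assoc 2 a (q + q)) ⟩
    (k + 1) * 2 ^ (a * (q + q)) + 2 ^ a * 2 ^ (a * (q + q))
      ≡⟨ sym (*-distribʳ-+ (2 ^ (a * (q + q))) (k + 1) (2 ^ a)) ⟩
    (k + 1 + 2 ^ a) * 2 ^ (a * (q + q)) ∎

  -- This fixes the factor 4 in `4 * a`: the exponents add up to 2 q + 2 a q, which is at most 4 a q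
  -- and so at most `ℓ`. The two factors `2 ^ q` are reserved for the square of the logarithm in
  -- `quadratic`.
  power≤n : 2 ^ q * 2 ^ q * 2 ^ (a * (q + q)) ≤ n
  power≤n = begin
    2 ^ q * 2 ^ q * 2 ^ (a * (q + q))
      ≡⟨ cong (_* 2 ^ (a * (q + q))) (sym (^-distribˡ-+-* 2 q q)) ⟩
    2 ^ (q + q) * 2 ^ (a * (q + q))
      ≡⟨ sym (^-distribˡ-+-* 2 (q + q) (a * (q + q))) ⟩
    2 ^ (q + q + a * (q + q))
      ≤⟨ ^-monoʳ-≤ 2 (begin
           q + q + a * (q + q)           ≤⟨ +-monoˡ-≤ (a * (q + q)) (m≤n*m (q + q) a {{>-nonZero 1≤a}}) ⟩
           a * (q + q) + a * (q + q)     ≡⟨ solve 2 (λ x y → x :* (y :+ y) :+ x :* (y :+ y) := y :* (con 4 :* x)) refl a q ⟩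
           q * d                         ≤⟨ lower ⟩
           ℓ                             ∎) ⟩
    2 ^ ℓ
      ≤⟨ 2^ℓ≤n ⟩
    n ∎
    where open +-*-Solver

  -- After multiplication by `L` both parts are linear in n: `L` is at most `d` times q + 1, which
  -- cancels the division by `suc q`, and also at most `d` times `2 ^ q`, which `power≤n` absorbs.
  exponent≤ : L * (k + 1) + (n / suc q + L * M) ≤ (constant k a * n) / L
  exponent≤ = m*n≤o⇒m≤o/n _ L (constant k a * n) (begin
    (L * (k + 1) + (n / suc q + L * M)) * L
      ≡⟨ solve 4 (λ l κ r m → (l :* κ :+ (r :+ l :* m)) :* l := l :* l :* (κ :+ m) :+ r :* l) refl L (k + 1) (n / suc q) M ⟩
    L * L * (k + 1 + M) + n / suc q * L
      ≤⟨ +-mono-≤ quadratic (≤-trans (*-monoʳ-≤ (n / suc q) upper) linear) ⟩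
    d * d * (k + 1 + 2 ^ a) * n + d * n
      ≡⟨ sym (*-distribʳ-+ n (d * d * (k + 1 + 2 ^ a)) d) ⟩
    constant k a * n ∎)
    where
    open +-*-Solver
    linear : n / suc q * (suc q * d) ≤ d * n
    linear = begin
      n / suc q * (suc q * d) ≡⟨ sym (*-assoc (n / suc q) (suc q) d) ⟩
      n / suc q * suc q * d   ≤⟨ *-monoˡ-≤ d (m/n*n≤m n (suc q)) ⟩
      n * d                   ≡⟨ *-comm n d ⟩
      d * n                   ∎
    L≤′ : L ≤ 2 ^ q * d
    L≤′ = ≤-trans upper (*-monoˡ-≤ d (suc≤2^ q))
    quadratic : L * L * (k + 1 + M) ≤ d * d * (k + 1 + 2 ^ a) * n
    quadratic = begin
      L * L * (k + 1 + M)
        ≤⟨ *-mono-≤ (*-mono-≤ L≤′ L≤′) M≤ ⟩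
      2 ^ q * d * (2 ^ q * d) * ((k + 1 + 2 ^ a) * 2 ^ (a * (q + q)))
        ≡⟨ solve 4 (λ x y z w → x :* y :* (x :* y) :* (z :* w) := y :* y :* z :* (x :* x :* w)) refl
             (2 ^ q) d (k + 1 + 2 ^ a) (2 ^ (a * (q + q))) ⟩
      d * d * (k + 1 + 2 ^ a) * (2 ^ q * 2 ^ q * 2 ^ (a * (q + q)))
        ≤⟨ *-monoʳ-≤ (d * d * (k + 1 + 2 ^ a)) power≤n ⟩
      d * d * (k + 1 + 2 ^ a) * n ∎

  total≤ : suc n ^ (k + 1) * (2 ^ (n / suc q) * suc n ^ M) ≤ 2 ^ ((constant k a * n) / L)
  total≤ = begin
    suc n ^ (k + 1) * (2 ^ (n / suc q) * suc n ^ M)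
      ≤⟨ *-mono-≤ (power (k + 1)) (*-monoʳ-≤ (2 ^ (n / suc q)) (power M)) ⟩
    2 ^ (L * (k + 1)) * (2 ^ (n / suc q) * 2 ^ (L * M))
      ≡⟨ cong (2 ^ (L * (k + 1)) *_) (sym (^-distribˡ-+-* 2 (n / suc q) (L * M))) ⟩
    2 ^ (L * (k + 1)) * 2 ^ (n / suc q + L * M)
      ≡⟨ sym (^-distribˡ-+-* 2 (L * (k + 1)) (n / suc q + L * M)) ⟩
    2 ^ (L * (k + 1) + (n / suc q + L * M))
      ≤⟨ ^-monoʳ-≤ 2 exponent≤ ⟩
    2 ^ ((constant k a * n) / L) ∎
    where
    power : ∀ e → suc n ^ e ≤ 2 ^ (L * e)
    power e = begin
      suc n ^ e       ≤⟨ ^-monoˡ-≤ e (n<2^[1+ℓ]) ⟩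
      (2 ^ L) ^ e     ≡⟨ ^-*-assoc 2 L e ⟩
      2 ^ (L * e)     ∎

-- Collecting the representatives over all separators

module Collect {n k : ℕ} (G : Graph n) (colour : Fin n → Fin (suc k)) (F : Forest (Fin n))
  (valid : Elimination.Valid G colour F) (all∈ : ∀ v → v ∈ verts F) (q : ℕ) where

  module S = Separator G colour F valid all∈ q

  small? : Decidable (λ (X : Subset n) → ∣ X ∣ ≤ k + 1)
  small? X = ∣ X ∣ ≤? k + 1

  separators : List (Subset n)
  separators = filter small? (smallSubsets n (k + 1))

  pairs : Subset n → List (Subset n × Subset n)
  pairs X = map (X ,_) (S.selection X)

  collected : List (Subset n × Subset n)
  collected = concatMap pairs separators

  length-pairs : ∀ X → length (pairs X) ≤ 2 ^ (n / suc q) * suc n ^ ((2 + vertexTypes k) ^ suc (q + q))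
  length-pairs X = begin
    length (pairs X)
      ≡⟨ length-map (X ,_) (S.selection X) ⟩
    length (S.selection X)
      ≤⟨ S.length-selection X ⟩
    2 ^ length (S.large X) * suc n ^ length (S.codes X)
      ≤⟨ *-mono-≤ (^-monoʳ-≤ 2 (m*n≤o⇒m≤o/n (length (S.large X)) (suc q) n (S.length-large X)))
                  (^-monoʳ-≤ (suc n) (S.length-codes X)) ⟩
    2 ^ (n / suc q) * suc n ^ ((2 + vertexTypes k) ^ suc (q + q)) ∎

  length-collected : length collected ≤
    suc n ^ (k + 1) * (2 ^ (n / suc q) * suc n ^ ((2 + vertexTypes k) ^ suc (q + q)))
  length-collected = ≤-trans (length-concatMap pairs separators (All.universal length-pairs separators))
    (*-monoˡ-≤ _ (≤-trans (length-filter small? (smallSubsets n (k + 1))) (length-smallSubsets n (k + 1))))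

  collected-good : All (GoodPair G k) collected
  collected-good = All.concat⁺ (All.map⁺ (All.map
    (λ {X} X≤ → All.map⁺ (All.map (λ (disj , nbrs) → X≤ , disj , nbrs) (S.selection-closed X)))
    (All.all-filter small? (smallSubsets n (k + 1)))))

  collected-complete : ∀ X W → GoodPair G k (X , W) → Any (Iso G (X , W)) collected
  collected-complete X W (X≤ , disj , nbrs) =
    let Z , Z∈ , iso = S.selection-complete X (subst (∣ X ∣ ≤_) (+-comm k 1) X≤) (disj , nbrs)
    in lose (∈-concatMap⁺ pairs (lose (∈-filter⁺ small? (∈-smallSubsets X X≤) X≤) (∈-map⁺ (X ,_) Z∈))) iso

theorem1 : (k : ℕ) → ∃ λ (C : ℕ) → ∃ λ (N₀ : ℕ) →
    ∀ (n : ℕ) → N₀ ≤ n → (G : Graph n) → TreewidthAtMost G k →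
    ∃ λ (reps : List (Subset n × Subset n)) →
    (length reps ≤ 2 ^ ((C * n) / suc ⌊log₂ n ⌋)) ×
    All (GoodPair G k) reps ×
    (∀ X W → GoodPair G k (X , W) → Any (Iso G (X , W)) reps)
-- The threshold is 1 because `2 ^ ⌊log₂ n ⌋ ≤ n` fails at n = 0.
theorem1 k = constant k a , 1 , λ n 1≤n G D →
  let colour , F , valid , all∈ = Exploration.eliminationForest D
      -- Small components, with at most q vertices, have at most a ^ (2 q + 1) = o(n / log² n) types.
      q = ⌊log₂ n ⌋ / (4 * a)
      open Collect G colour F valid all∈ q
      open Exponent {k} {a} {n} {⌊log₂ n ⌋} {q} (s≤s z≤n) (2^⌊log₂n⌋≤n n 1≤n) (n<2^[1+⌊log₂n⌋] n)
             (m/n*n≤m ⌊log₂ n ⌋ (4 * a)) (1+m≤[1+m/n]*n ⌊log₂ n ⌋ (4 * a))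
  in collected , ≤-trans length-collected total≤ , collected-good , collected-complete
  where
  -- The base for counting codes: at most `vertexTypes k` labels, the symbol `nothing`, and the end
  -- mark from `length-words`.
  a : ℕ
  a = 2 + vertexTypes k
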